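{- Let $k\geqslant1$ and let $$\varrho(z)=\sum_{\gamma=\begin{pmatrix}a&b\\c&d\end{pmatrix}\in G}\frac{\det(\gamma)^k}{(az+b)^k(cz+d)^k},$$ so that $\varrho(z)\,(\mathrm{d}z)^k=\sum_{\gamma\in G}\gamma^*s(z;\infty,0)^k$. Then $\varrho=-P_{2k,k}$, where $P_{2k,k}$ is the Drinfeld–Poincaré series.
   Context: $q$ is an odd prime power, $A=\mathbb{F}_q[T]$, $G=\mathrm{GL}_2(A)$, $F_\infty=\mathbb{F}_q((1/T))$, $\mathbb{C}_\infty$ is the completion of an algebraic closure of $F_\infty$, $z\in\Omega=\mathbb{C}_\infty\setminus F_\infty$; $j_\gamma(z)=cz+d$ for $\gamma=\begin{pmatrix}a&b\\c&d\end{pmatrix}$. $s(z;\infty,0)=\mathrm{d}z/z$, and $\gamma^*$ denotes pullback under $z\mapsto\gamma z$. The series $\varrho$ converges locally uniformly on $\Omega$. $e_A(z)=z\prod_{b\in A\setminus\{0\}}(1-z/b)$ and $t_A=1/e_A$. For $n\geqslant1$, the $n$-th Goss polynomial $G_{n,A}(X)\in\mathbb{C}_\infty[X]$ is the unique polynomial with $\sum_{b\in A}(z-b)^{ -n}=G_{n,A}(t_A(z))$ for all $z\notin A$. For $w,n\geqslant1$, with $m$ the class of $n$ modulo $q-1$ and $K=\begin{pmatrix}\mathbb{F}_q^\times&A\\0&1\end{pmatrix}$, the Drinfeld–Poincaré series is $$P_{w,n}(z)=\sum_{[\gamma]\in K\backslash G}\frac{\det(\gamma)^m}{j_\gamma(z)^w}\,G_{n,A}(t_A(\gamma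 z)).$$ -}

module Defs where

open import Algebra.Bundles using (CommutativeRing)
open import Algebra.Morphism.Structures using (IsRingHomomorphism)
import Algebra.Properties.Ring as RingProperties
import Algebra.Properties.CommutativeSemigroup as CommutativeSemigroupProperties
open import Data.Fin.Base using (Fin)
open import Data.List.Base using (List; []; _∷_; map; foldr; upTo)
open import Data.List.Relation.Unary.All using (All)
import Data.List.Relation.Binary.Subset.Setoid as Subset
import Data.List.Relation.Unary.Unique.Setoid as Unique
open import Data.Nat.Base as ℕ using (ℕ; zero; suc; ∣_-_∣)
open import Data.Nat.Divisibility using (_∣_)
open import Data.Nat.Primality using (Prime)
open import Data.Product.Base using (Σ; ∃; ∃-syntax; ∃₂; _×_; _,_; proj₁)
open import Data.Rational.Base as ℚ using (ℚ; 0ℚ; 1ℚ)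
open import Function.Bundles using (Inverse)
open import Level using (Level; _⊔_) renaming (suc to lsuc)
open import Relation.Binary.Bundles using (Setoid)
import Relation.Binary.Construct.Add.Supremum.NonStrict as Supremum
import Relation.Binary.Construct.On as On
open import Relation.Binary.PropositionalEquality.Core as ≡ using (_≡_; _≢_)
import Relation.Binary.PropositionalEquality.Properties as ≡
import Relation.Binary.Reasoning.Setoid as SetoidReasoning
open import Relation.Nullary.Construct.Add.Supremum using (_⁺; [_]; ⊤⁺)
open import Relation.Nullary.Negation.Core using (¬_)

-- The inverse is total; its value at 0# is unspecified.
record Field c ℓ : Set (lsuc (c ⊔ ℓ)) where
  infix 9 _⁻¹
  field
    commutativeRing : CommutativeRing c ℓ
  open CommutativeRing commutativeRing public
  field
    1≉0      : 1# ≉ 0#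
    _⁻¹      : Carrier → Carrier
    ⁻¹-cong  : ∀ {x y} → x ≈ y → x ⁻¹ ≈ y ⁻¹
    inverseʳ : ∀ {x} → x ≉ 0# → x * x ⁻¹ ≈ 1#
  open import Algebra.Properties.Semiring.Exp semiring public using (_^_)

record FiniteField c ℓ (q : ℕ) : Set (lsuc (c ⊔ ℓ)) where
  field
    asField : Field c ℓ
  open Field asField public
  field
    enumeration : Inverse setoid (≡.setoid (Fin q))

OddPrimePower : ℕ → Set
OddPrimePower q = ∃₂ λ p r → Prime p × p ≢ 2 × 1 ℕ.≤ r × q ≡ p ℕ.^ r

infix 4 _≡_mod_
_≡_mod_ : ℕ → ℕ → ℕ → Set
m ≡ n mod N = N ∣ ∣ m - n ∣

-- Coefficient lists, constant term first, up to trailing zeros.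
module Polynomial {c ℓ} (R : CommutativeRing c ℓ) where
  open CommutativeRing R
  open RingProperties ring using (-0#≈0#)
  open CommutativeSemigroupProperties +-commutativeSemigroup
    using () renaming (interchange to +-interchange)

  Poly : Set c
  Poly = List Carrier

  coeff : Poly → ℕ → Carrier
  coeff []      _       = 0#
  coeff (a ∷ p) zero    = a
  coeff (a ∷ p) (suc n) = coeff p n

  infix 4 _≋_
  record _≋_ (p q : Poly) : Set ℓ where
    constructor mk
    field at : ∀ n → coeff p n ≈ coeff q n
  open _≋_ public

  infixl 6 _⊕_
  infixl 7 _⊗_ _·_

  _⊕_ : Poly → Poly → Poly
  []      ⊕ q       = q
  (a ∷ p) ⊕ []      = a ∷ p
  (a ∷ p) ⊕ (b ∷ q) = a + b ∷ p ⊕ q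

  _·_ : Carrier → Poly → Poly
  a · p = map (a *_) p

  _⊗_ : Poly → Poly → Poly
  []      ⊗ q = []
  (a ∷ p) ⊗ q = a · q ⊕ (0# ∷ p ⊗ q)

  ⊝_ : Poly → Poly
  ⊝ p = map -_ p

  const : Carrier → Poly
  const a = a ∷ []

  eval : Poly → Carrier → Carrier
  eval []      x = 0#
  eval (a ∷ p) x = a + x * eval p x

  coeff-⊕ : ∀ p q n → coeff (p ⊕ q) n ≈ coeff p n + coeff q n
  coeff-⊕ []      q       n       = sym (+-identityˡ _)
  coeff-⊕ (a ∷ p) []      n       = sym (+-identityʳ _)
  coeff-⊕ (a ∷ p) (b ∷ q) zero    = refl
  coeff-⊕ (a ∷ p) (b ∷ q) (suc n) = coeff-⊕ p q n

  coeff-· : ∀ a p n → coeff (a · p) n ≈ a * coeff p n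
  coeff-· a []      n       = sym (zeroʳ a)
  coeff-· a (b ∷ p) zero    = refl
  coeff-· a (b ∷ p) (suc n) = coeff-· a p n

  coeff-⊝ : ∀ p n → coeff (⊝ p) n ≈ - coeff p n
  coeff-⊝ []      n       = sym -0#≈0#
  coeff-⊝ (b ∷ p) zero    = refl
  coeff-⊝ (b ∷ p) (suc n) = coeff-⊝ p n

  ≋-refl : ∀ {p} → p ≋ p
  ≋-refl .at n = refl

  ≋-sym : ∀ {p q} → p ≋ q → q ≋ p
  ≋-sym e .at n = sym (e .at n)

  ≋-trans : ∀ {p q r} → p ≋ q → q ≋ r → p ≋ r
  ≋-trans e f .at n = trans (e .at n) (f .at n)

  ≋-setoid : Setoid c ℓ
  ≋-setoid = record
    { Carrier = Poly ; _≈_ = _≋_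
    ; isEquivalence = record { refl = ≋-refl ; sym = ≋-sym ; trans = ≋-trans } }

  ∷-cong : ∀ {a b p q} → a ≈ b → p ≋ q → a ∷ p ≋ b ∷ q
  ∷-cong e f .at zero    = e
  ∷-cong e f .at (suc n) = f .at n

  0∷[]≋[] : 0# ∷ [] ≋ []
  0∷[]≋[] .at zero    = refl
  0∷[]≋[] .at (suc n) = refl

  ⊕-cong : ∀ {p p′ q q′} → p ≋ p′ → q ≋ q′ → p ⊕ q ≋ p′ ⊕ q′
  ⊕-cong {p} {p′} {q} {q′} e f .at n =
    trans (coeff-⊕ p q n) (trans (+-cong (e .at n) (f .at n)) (sym (coeff-⊕ p′ q′ n)))

  ·-cong : ∀ {a b p q} → a ≈ b → p ≋ q → a · p ≋ b · q
  ·-cong {a} {b} {p} {q} e f .at n =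
    trans (coeff-· a p n) (trans (*-cong e (f .at n)) (sym (coeff-· b q n)))

  ⊝-cong : ∀ {p q} → p ≋ q → ⊝ p ≋ ⊝ q
  ⊝-cong {p} {q} e .at n =
    trans (coeff-⊝ p n) (trans (-‿cong (e .at n)) (sym (coeff-⊝ q n)))

  ⊕-assoc : ∀ p q r → (p ⊕ q) ⊕ r ≋ p ⊕ (q ⊕ r)
  ⊕-assoc p q r .at n = begin
    coeff ((p ⊕ q) ⊕ r) n                 ≈⟨ coeff-⊕ (p ⊕ q) r n ⟩
    coeff (p ⊕ q) n + coeff r n           ≈⟨ +-congʳ (coeff-⊕ p q n) ⟩
    (coeff p n + coeff q n) + coeff r n   ≈⟨ +-assoc _ _ _ ⟩
    coeff p n + (coeff q n + coeff r n)   ≈⟨ +-congˡ (coeff-⊕ q r n) ⟨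
    coeff p n + coeff (q ⊕ r) n           ≈⟨ coeff-⊕ p (q ⊕ r) n ⟨
    coeff (p ⊕ (q ⊕ r)) n                 ∎
    where open SetoidReasoning setoid

  ⊕-comm : ∀ p q → p ⊕ q ≋ q ⊕ p
  ⊕-comm p q .at n =
    trans (coeff-⊕ p q n) (trans (+-comm _ _) (sym (coeff-⊕ q p n)))

  ⊕-identityʳ : ∀ p → p ⊕ [] ≋ p
  ⊕-identityʳ p = ⊕-comm p []

  ⊝-inverseʳ : ∀ p → p ⊕ ⊝ p ≋ []
  ⊝-inverseʳ p .at n =
    trans (coeff-⊕ p (⊝ p) n) (trans (+-congˡ (coeff-⊝ p n)) (-‿inverseʳ _))

  ⊕-interchange : ∀ p q r s → (p ⊕ q) ⊕ (r ⊕ s) ≋ (p ⊕ r) ⊕ (q ⊕ s)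
  ⊕-interchange p q r s .at n = begin
    coeff ((p ⊕ q) ⊕ (r ⊕ s)) n
      ≈⟨ coeff-⊕ (p ⊕ q) (r ⊕ s) n ⟩
    coeff (p ⊕ q) n + coeff (r ⊕ s) n
      ≈⟨ +-cong (coeff-⊕ p q n) (coeff-⊕ r s n) ⟩
    (coeff p n + coeff q n) + (coeff r n + coeff s n)
      ≈⟨ +-interchange _ _ _ _ ⟩
    (coeff p n + coeff r n) + (coeff q n + coeff s n)
      ≈⟨ +-cong (coeff-⊕ p r n) (coeff-⊕ q s n) ⟨
    coeff (p ⊕ r) n + coeff (q ⊕ s) n
      ≈⟨ coeff-⊕ (p ⊕ r) (q ⊕ s) n ⟨
    coeff ((p ⊕ r) ⊕ (q ⊕ s)) n ∎
    where open SetoidReasoning setoid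

  ·-distribˡ : ∀ a p q → a · (p ⊕ q) ≋ a · p ⊕ a · q
  ·-distribˡ a p q .at n = begin
    coeff (a · (p ⊕ q)) n              ≈⟨ coeff-· a (p ⊕ q) n ⟩
    a * coeff (p ⊕ q) n                ≈⟨ *-congˡ (coeff-⊕ p q n) ⟩
    a * (coeff p n + coeff q n)        ≈⟨ distribˡ _ _ _ ⟩
    a * coeff p n + a * coeff q n      ≈⟨ +-cong (coeff-· a p n) (coeff-· a q n) ⟨
    coeff (a · p) n + coeff (a · q) n  ≈⟨ coeff-⊕ (a · p) (a · q) n ⟨
    coeff (a · p ⊕ a · q) n            ∎
    where open SetoidReasoning setoid

  ·-assoc : ∀ a b p → (a * b) · p ≋ a · (b · p)
  ·-assoc a b p .at n = begin
    coeff ((a * b) · p) n  ≈⟨ coeff-· (a * b) p n ⟩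
    (a * b) * coeff p n    ≈⟨ *-assoc _ _ _ ⟩
    a * (b * coeff p n)    ≈⟨ *-congˡ (coeff-· b p n) ⟨
    a * coeff (b · p) n    ≈⟨ coeff-· a (b · p) n ⟨
    coeff (a · (b · p)) n  ∎
    where open SetoidReasoning setoid

  ·-identity : ∀ p → 1# · p ≋ p
  ·-identity p .at n = trans (coeff-· 1# p n) (*-identityˡ _)

  ·-zero : ∀ p → 0# · p ≋ []
  ·-zero p .at n = trans (coeff-· 0# p n) (zeroˡ _)

  ⊗-congˡ : ∀ p {q r} → q ≋ r → p ⊗ q ≋ p ⊗ r
  ⊗-congˡ []      e = ≋-refl
  ⊗-congˡ (a ∷ p) e = ⊕-cong (·-cong refl e) (∷-cong refl (⊗-congˡ p e))

  ⊗-zeroʳ : ∀ p → p ⊗ [] ≋ []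
  ⊗-zeroʳ []      = ≋-refl
  ⊗-zeroʳ (a ∷ p) = ≋-trans (∷-cong refl (⊗-zeroʳ p)) 0∷[]≋[]

  ⊗-∷ : ∀ p b q → p ⊗ (b ∷ q) ≋ b · p ⊕ (0# ∷ p ⊗ q)
  ⊗-∷ []      b q = ≋-sym 0∷[]≋[]
  ⊗-∷ (a ∷ p) b q = ∷-cong (+-congʳ (*-comm a b)) (begin
    a · q ⊕ p ⊗ (b ∷ q)              ≈⟨ ⊕-cong ≋-refl (⊗-∷ p b q) ⟩
    a · q ⊕ (b · p ⊕ (0# ∷ p ⊗ q))   ≈⟨ ⊕-assoc (a · q) (b · p) _ ⟨
    (a · q ⊕ b · p) ⊕ (0# ∷ p ⊗ q)   ≈⟨ ⊕-cong (⊕-comm (a · q) (b · p)) ≋-refl ⟩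
    (b · p ⊕ a · q) ⊕ (0# ∷ p ⊗ q)   ≈⟨ ⊕-assoc (b · p) (a · q) _ ⟩
    b · p ⊕ (a · q ⊕ (0# ∷ p ⊗ q))   ∎)
    where open SetoidReasoning ≋-setoid

  ⊗-comm : ∀ p q → p ⊗ q ≋ q ⊗ p
  ⊗-comm []      q = ≋-sym (⊗-zeroʳ q)
  ⊗-comm (a ∷ p) q =
    ≋-trans (⊕-cong ≋-refl (∷-cong refl (⊗-comm p q))) (≋-sym (⊗-∷ q a p))

  ⊗-cong : ∀ {p p′ q q′} → p ≋ p′ → q ≋ q′ → p ⊗ q ≋ p′ ⊗ q′
  ⊗-cong {p} {p′} {q} {q′} e f = begin
    p ⊗ q    ≈⟨ ⊗-congˡ p f ⟩
    p ⊗ q′   ≈⟨ ⊗-comm p q′ ⟩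
    q′ ⊗ p   ≈⟨ ⊗-congˡ q′ e ⟩
    q′ ⊗ p′  ≈⟨ ⊗-comm q′ p′ ⟩
    p′ ⊗ q′  ∎
    where open SetoidReasoning ≋-setoid

  ⊗-distribˡ : ∀ p q r → p ⊗ (q ⊕ r) ≋ p ⊗ q ⊕ p ⊗ r
  ⊗-distribˡ []      q r = ≋-refl
  ⊗-distribˡ (a ∷ p) q r = begin
    a · (q ⊕ r) ⊕ (0# ∷ p ⊗ (q ⊕ r))
      ≈⟨ ⊕-cong (·-distribˡ a q r) (∷-cong (sym (+-identityʳ 0#)) (⊗-distribˡ p q r)) ⟩
    (a · q ⊕ a · r) ⊕ ((0# ∷ p ⊗ q) ⊕ (0# ∷ p ⊗ r))
      ≈⟨ ⊕-interchange (a · q) (a · r) _ _ ⟩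
    (a · q ⊕ (0# ∷ p ⊗ q)) ⊕ (a · r ⊕ (0# ∷ p ⊗ r)) ∎
    where open SetoidReasoning ≋-setoid

  ⊗-distribʳ : ∀ p q r → (q ⊕ r) ⊗ p ≋ q ⊗ p ⊕ r ⊗ p
  ⊗-distribʳ p q r = begin
    (q ⊕ r) ⊗ p     ≈⟨ ⊗-comm (q ⊕ r) p ⟩
    p ⊗ (q ⊕ r)     ≈⟨ ⊗-distribˡ p q r ⟩
    p ⊗ q ⊕ p ⊗ r   ≈⟨ ⊕-cong (⊗-comm p q) (⊗-comm p r) ⟩
    q ⊗ p ⊕ r ⊗ p   ∎
    where open SetoidReasoning ≋-setoid

  ·-⊗ : ∀ a p q → (a · p) ⊗ q ≋ a · (p ⊗ q)
  ·-⊗ a []      q = ≋-refl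
  ·-⊗ a (b ∷ p) q = begin
    (a * b) · q ⊕ (0# ∷ (a · p) ⊗ q)
      ≈⟨ ⊕-cong (·-assoc a b q) (∷-cong (sym (zeroʳ a)) (·-⊗ a p q)) ⟩
    a · (b · q) ⊕ a · (0# ∷ p ⊗ q)
      ≈⟨ ·-distribˡ a (b · q) (0# ∷ p ⊗ q) ⟨
    a · (b · q ⊕ (0# ∷ p ⊗ q)) ∎
    where open SetoidReasoning ≋-setoid

  ⊗-assoc : ∀ p q r → (p ⊗ q) ⊗ r ≋ p ⊗ (q ⊗ r)
  ⊗-assoc []      q r = ≋-refl
  ⊗-assoc (a ∷ p) q r = begin
    (a · q ⊕ (0# ∷ p ⊗ q)) ⊗ r
      ≈⟨ ⊗-distribʳ r (a · q) _ ⟩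
    (a · q) ⊗ r ⊕ (0# · r ⊕ (0# ∷ (p ⊗ q) ⊗ r))
      ≈⟨ ⊕-cong (·-⊗ a q r) (⊕-cong (·-zero r) (∷-cong refl (⊗-assoc p q r))) ⟩
    a · (q ⊗ r) ⊕ (0# ∷ p ⊗ (q ⊗ r)) ∎
    where open SetoidReasoning ≋-setoid

  ⊗-identityˡ : ∀ p → const 1# ⊗ p ≋ p
  ⊗-identityˡ p = ≋-trans (⊕-cong (·-identity p) 0∷[]≋[]) (⊕-identityʳ p)

  polynomialRing : CommutativeRing c ℓ
  polynomialRing = record
    { Carrier = Poly ; _≈_ = _≋_ ; _+_ = _⊕_ ; _*_ = _⊗_ ; -_ = ⊝_
    ; 0# = [] ; 1# = const 1#
    ; isCommutativeRing = record
      { isRing = record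
        { +-isAbelianGroup = record
          { isGroup = record
            { isMonoid = record
              { isSemigroup = record
                { isMagma = record
                  { isEquivalence = Setoid.isEquivalence ≋-setoid ; ∙-cong = ⊕-cong }
                ; assoc = ⊕-assoc }
              ; identity = (λ _ → ≋-refl) , ⊕-identityʳ }
            ; inverse = (λ p → ≋-trans (⊕-comm (⊝ p) p) (⊝-inverseʳ p)) , ⊝-inverseʳ
            ; ⁻¹-cong = ⊝-cong }
          ; comm = ⊕-comm }
        ; *-cong = ⊗-cong
        ; *-assoc = ⊗-assoc
        ; *-identity = ⊗-identityˡ ,
                       λ p → ≋-trans (⊗-comm p (const 1#)) (⊗-identityˡ p)
        ; distrib = ⊗-distribˡ , ⊗-distribʳ }
      ; *-comm = ⊗-comm } }

  const-* : ∀ a b → const a ⊗ const b ≋ const (a * b)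
  const-* a b = ∷-cong (+-identityʳ _) ≋-refl

module Matrices {r ℓ} (R : CommutativeRing r ℓ) where
  open CommutativeRing R

  record M₂ : Set r where
    constructor mat
    field a b c d : Carrier

  infix 4 _≈ₘ_
  record _≈ₘ_ (γ δ : M₂) : Set ℓ where
    constructor mat≈
    private
      module γ = M₂ γ
      module δ = M₂ δ
    field
      a≈ : γ.a ≈ δ.a
      b≈ : γ.b ≈ δ.b
      c≈ : γ.c ≈ δ.c
      d≈ : γ.d ≈ δ.d

  infixl 7 _*ₘ_
  _*ₘ_ : M₂ → M₂ → M₂
  mat a b c d *ₘ mat a′ b′ c′ d′ =
    mat (a * a′ + b * c′) (a * b′ + b * d′) (c * a′ + d * c′) (c * b′ + d * d′)

  det : M₂ → Carrier
  det (mat a b c d) = a * d - b * c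

  M₂-setoid : Setoid r ℓ
  M₂-setoid = record
    { Carrier = M₂
    ; _≈_ = _≈ₘ_
    ; isEquivalence = record
      { refl  = mat≈ refl refl refl refl
      ; sym   = λ { (mat≈ p q r s) → mat≈ (sym p) (sym q) (sym r) (sym s) }
      ; trans = λ { (mat≈ p q r s) (mat≈ p′ q′ r′ s′) →
                    mat≈ (trans p p′) (trans q q′) (trans r r′) (trans s s′) } } }

  IsUnit : Carrier → Set (r ⊔ ℓ)
  IsUnit x = ∃[ y ] x * y ≈ 1#

  GL₂ : Set (r ⊔ ℓ)
  GL₂ = Σ M₂ λ γ → IsUnit (det γ)

  GL₂-setoid : Setoid (r ⊔ ℓ) ℓ
  GL₂-setoid = On.setoid M₂-setoid (proj₁ {B = λ γ → IsUnit (det γ)})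

  affine : Carrier → Carrier → M₂
  affine u β = mat u β 0# 1#

  private
    bot : ∀ x y → 0# * x + 1# * y ≈ y
    bot x y = trans (+-cong (zeroˡ x) (*-identityˡ y)) (+-identityˡ y)

    top-refl : ∀ x y → x ≈ 1# * x + 0# * y
    top-refl x y = sym (trans (+-comm _ _) (bot y x))

    top-sym : ∀ {u v β x x′ y y′} → u * v ≈ 1# → x′ ≈ v * x + β * y → y′ ≈ y →
              x ≈ u * x′ + (- (u * β)) * y′
    top-sym {u} {v} {β} {x} {x′} {y} {y′} e f g = sym (begin
      u * x′ + (- (u * β)) * y′
        ≈⟨ +-cong (*-congˡ f) (*-congˡ g) ⟩
      u * (v * x + β * y) + (- (u * β)) * y
        ≈⟨ +-cong (distribˡ u _ _) (sym (RingProperties.-‿distribˡ-* ring _ _)) ⟩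
      (u * (v * x) + u * (β * y)) + - ((u * β) * y)
        ≈⟨ +-congˡ (-‿cong (*-assoc u β y)) ⟩
      (u * (v * x) + u * (β * y)) + - (u * (β * y))
        ≈⟨ +-assoc _ _ _ ⟩
      u * (v * x) + (u * (β * y) + - (u * (β * y)))
        ≈⟨ +-cong (sym (*-assoc u v x)) (-‿inverseʳ _) ⟩
      (u * v) * x + 0#
        ≈⟨ +-identityʳ _ ⟩
      (u * v) * x
        ≈⟨ *-congʳ e ⟩
      1# * x
        ≈⟨ *-identityˡ x ⟩
      x ∎)
      where open SetoidReasoning setoid

    top-trans : ∀ {u v w β β′ x x′ x″ y y′} → v * u ≈ w →
                x′ ≈ u * x + β * y → y′ ≈ y → x″ ≈ v * x′ + β′ * y′ →
                x″ ≈ w * x + (v * β + β′) * y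
    top-trans {u} {v} {w} {β} {β′} {x} {x′} {x″} {y} {y′} e f g h = begin
      x″                                   ≈⟨ h ⟩
      v * x′ + β′ * y′                     ≈⟨ +-cong (*-congˡ f) (*-congˡ g) ⟩
      v * (u * x + β * y) + β′ * y         ≈⟨ +-congʳ (distribˡ v _ _) ⟩
      (v * (u * x) + v * (β * y)) + β′ * y ≈⟨ +-assoc _ _ _ ⟩
      v * (u * x) + (v * (β * y) + β′ * y)
        ≈⟨ +-cong (*-assoc v u x) (+-congʳ (*-assoc v β y)) ⟨
      (v * u) * x + ((v * β) * y + β′ * y)
        ≈⟨ +-cong (*-congʳ e) (sym (distribʳ y _ _)) ⟩
      w * x + (v * β + β′) * y             ∎
      where open SetoidReasoning setoid

  affine-refl : ∀ γ → γ ≈ₘ affine 1# 0# *ₘ γ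
  affine-refl (mat a b c d) =
    mat≈ (top-refl a c) (top-refl b d) (sym (bot a c)) (sym (bot b d))

  affine-sym : ∀ u v β γ δ → u * v ≈ 1# →
    δ ≈ₘ affine v β *ₘ γ → γ ≈ₘ affine u (- (u * β)) *ₘ δ
  affine-sym u v β (mat a b c d) (mat a′ b′ c′ d′) e (mat≈ p q r s) =
    mat≈ (top-sym e p r′) (top-sym e q s′)
         (sym (trans (bot a′ c′) r′)) (sym (trans (bot b′ d′) s′))
    where
      r′ = trans r (bot a c)
      s′ = trans s (bot b d)

  affine-trans : ∀ u v w β β′ γ δ ε → v * u ≈ w →
    δ ≈ₘ affine u β *ₘ γ → ε ≈ₘ affine v β′ *ₘ δ → ε ≈ₘ affine w (v * β + β′) *ₘ γ
  affine-trans u v w β β′ (mat a b c d) (mat a′ b′ c′ d′) ε e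
               (mat≈ p q r s) (mat≈ p′ q′ r′ s′) =
    mat≈ (top-trans e p (trans r (bot a c)) p′) (top-trans e q (trans s (bot b d)) q′)
         (trans r′ (trans (bot a′ c′) r)) (trans s′ (trans (bot b′ d′) s))

module Arithmetic {f ℓf q} (𝔽 : FiniteField f ℓf q) where
  private module 𝔽 = FiniteField 𝔽
  open Polynomial 𝔽.commutativeRing public
    using (const) renaming (Poly to A; polynomialRing to A-ring)
  private module P = Polynomial 𝔽.commutativeRing
  private module A = CommutativeRing A-ring
  open Matrices A-ring public

  A∖0-setoid : Setoid (f ⊔ ℓf) ℓf
  A∖0-setoid = On.setoid A.setoid (proj₁ {B = λ b → ¬ (b A.≈ A.0#)})

  G : Set (f ⊔ ℓf)
  G = GL₂

  G-setoid : Setoid (f ⊔ ℓf) ℓf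
  G-setoid = GL₂-setoid

  -- δ ∈ K γ, where K = ( 𝔽ˣ A ; 0 1 )
  infix 4 _≈ᴷ_
  _≈ᴷ_ : G → G → Set (f ⊔ ℓf)
  (γ , _) ≈ᴷ (δ , _) = ∃₂ λ α β → α 𝔽.≉ 𝔽.0# × δ ≈ₘ affine (const α) β *ₘ γ

  private
    inverse≉0 : ∀ {α} → α 𝔽.≉ 𝔽.0# → α 𝔽.⁻¹ 𝔽.≉ 𝔽.0#
    inverse≉0 α≉0 e = 𝔽.1≉0
      (𝔽.trans (𝔽.sym (𝔽.inverseʳ α≉0)) (𝔽.trans (𝔽.*-congˡ e) (𝔽.zeroʳ _)))

    product≉0 : ∀ {α β} → α 𝔽.≉ 𝔽.0# → β 𝔽.≉ 𝔽.0# → α 𝔽.* β 𝔽.≉ 𝔽.0#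
    product≉0 {α} {β} α≉0 β≉0 e = α≉0 (begin
      α                      ≈⟨ 𝔽.*-identityʳ α ⟨
      α 𝔽.* 𝔽.1#             ≈⟨ 𝔽.*-congˡ (𝔽.inverseʳ β≉0) ⟨
      α 𝔽.* (β 𝔽.* β 𝔽.⁻¹)   ≈⟨ 𝔽.*-assoc _ _ _ ⟨
      (α 𝔽.* β) 𝔽.* β 𝔽.⁻¹   ≈⟨ 𝔽.*-congʳ e ⟩
      𝔽.0# 𝔽.* β 𝔽.⁻¹        ≈⟨ 𝔽.zeroˡ _ ⟩
      𝔽.0#                   ∎)
      where open SetoidReasoning 𝔽.setoid

    const-inverse : ∀ {α} → α 𝔽.≉ 𝔽.0# → const (α 𝔽.⁻¹) A.* const α A.≈ A.1#
    const-inverse {α} α≉0 = A.trans (P.const-* (α 𝔽.⁻¹) α)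
      (P.∷-cong (𝔽.trans (𝔽.*-comm _ _) (𝔽.inverseʳ α≉0)) P.≋-refl)

  K\G-setoid : Setoid (f ⊔ ℓf) (f ⊔ ℓf)
  K\G-setoid = record
    { Carrier = G
    ; _≈_ = _≈ᴷ_
    ; isEquivalence = record
      { refl = λ { {γ , _} → 𝔽.1# , A.0# , 𝔽.1≉0 , affine-refl γ }
      ; sym = λ { {γ , _} {δ , _} (α , β , α≉0 , e) →
          α 𝔽.⁻¹ , (A.- (const (α 𝔽.⁻¹) A.* β)) , inverse≉0 α≉0 ,
          affine-sym (const (α 𝔽.⁻¹)) (const α) β γ δ (const-inverse α≉0) e }
      ; trans = λ { {γ , _} {δ , _} {ε , _} (α , β , α≉0 , e) (α′ , β′ , α′≉0 , e′) →
          α′ 𝔽.* α , const α′ A.* β A.+ β′ , product≉0 α′≉0 α≉0 ,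
          affine-trans (const α) (const α′) _ β β′ γ δ ε (P.const-* α′ α) e e′ } } }

open Supremum ℚ._≤_ public using (_≤⁺_)

infixl 6 _+⁺_
_+⁺_ : ℚ ⁺ → ℚ ⁺ → ℚ ⁺
[ r ] +⁺ [ s ] = [ r ℚ.+ s ]
[ r ] +⁺ ⊤⁺    = ⊤⁺
⊤⁺    +⁺ s     = ⊤⁺

-- Rational values suffice: for |x| = q^(- v x), the value group of ℂ∞ is ℚ.
record ValuedField c ℓ : Set (lsuc (c ⊔ ℓ)) where
  field
    asField : Field c ℓ
  open Field asField public
  field
    v            : Carrier → ℚ ⁺
    v-cong       : ∀ {x y} → x ≈ y → v x ≡ v y
    v-0          : v 0# ≡ ⊤⁺
    v-definite   : ∀ {x} → v x ≡ ⊤⁺ → x ≈ 0#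
    v-*          : ∀ x y → v (x * y) ≡ v x +⁺ v y
    v-ultrametric : ∀ {r} x y → r ≤⁺ v x → r ≤⁺ v y → r ≤⁺ v (x + y)

  open Polynomial commutativeRing public using (Poly; coeff; eval)

  Close : ℚ → Carrier → Carrier → Set
  Close r x y = [ r ] ≤⁺ v (x - y)

  Cauchy : (ℕ → Carrier) → Set
  Cauchy u = ∀ r → ∃[ N ] ∀ m n → N ℕ.≤ m → N ℕ.≤ n → Close r (u m) (u n)

  Converges : (ℕ → Carrier) → Carrier → Set
  Converges u x = ∀ r → ∃[ N ] ∀ n → N ℕ.≤ n → Close r (u n) x

  -- Limit along the finite subsets of a setoid, ordered by inclusion.
  module _ {i ℓi} (I : Setoid i ℓi) where
    open Setoid I using () renaming (Carrier to Index)
    open Subset I using (_⊆_)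
    open Unique I using (Unique)

    FinitaryLimit : (List Index → Carrier) → Carrier → Set (i ⊔ ℓi)
    FinitaryLimit F s = ∀ r → ∃[ L ] ∀ M → Unique M → L ⊆ M → Close r (F M) s

    HasSum : (Index → Carrier) → Carrier → Set (i ⊔ ℓi)
    HasSum f = FinitaryLimit λ M → foldr _+_ 0# (map f M)

    HasProduct : (Index → Carrier) → Carrier → Set (i ⊔ ℓi)
    HasProduct f = FinitaryLimit λ M → foldr _*_ 1# (map f M)

-- A completion of an algebraic closure of 𝔽((1/T)): a complete valued field
-- over 𝔽((1/T)), with the 1/T-adic valuation, in which the elements algebraic
-- over 𝔽((1/T)) form an algebraically closed, dense subfield. This determines
-- ℂ∞ up to isomorphism.
record CInfinity {f ℓf q} (𝔽 : FiniteField f ℓf q) c ℓ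
       : Set (f ⊔ ℓf ⊔ lsuc (c ⊔ ℓ)) where
  private module 𝔽 = FiniteField 𝔽
  field
    valuedField : ValuedField c ℓ
  open ValuedField valuedField public
  field
    ι         : 𝔽.Carrier → Carrier
    ι-hom     : IsRingHomomorphism 𝔽.rawRing rawRing ι
    T         : Carrier
    v-ι       : ∀ {a} → a 𝔽.≉ 𝔽.0# → v (ι a) ≡ [ 0ℚ ]
    v-T       : v T ≡ [ ℚ.- 1ℚ ]
    complete  : ∀ u → Cauchy u → ∃[ x ] Converges u x

  laurentSum : ℕ → (ℕ → 𝔽.Carrier) → ℕ → Carrier
  laurentSum N a n = foldr _+_ 0# (map (λ i → ι (a i) * (T ^ N * (T ⁻¹) ^ i)) (upTo n))

  -- x = Σ_{i≥0} aᵢ T^(N-i) for some N and a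
  InF∞ : Carrier → Set f
  InF∞ x = ∃₂ λ N a → Converges (laurentSum N a) x

  AlgebraicOverF∞ : Carrier → Set (f ⊔ c ⊔ ℓ)
  AlgebraicOverF∞ x = ∃[ p ] All InF∞ p × (∃[ i ] coeff p i ≉ 0#) × eval p x ≈ 0#

  field
    algebraicallyClosed : ∀ p i → All AlgebraicOverF∞ p → coeff p (suc i) ≉ 0# →
                          ∃[ x ] eval p x ≈ 0#
    algebraicDense      : ∀ x r → ∃[ y ] AlgebraicOverF∞ y × Close r x y

module Drinfeld {f ℓf q} {𝔽 : FiniteField f ℓf q} {c ℓ} (ℂ∞ : CInfinity 𝔽 c ℓ) where
  open CInfinity ℂ∞
  open Arithmetic 𝔽
  private module A = CommutativeRing A-ring

  ⟦_⟧ : A → Carrier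
  ⟦ p ⟧ = eval (map ι p) T

  _∈Ω : Carrier → Set f
  z ∈Ω = ¬ InF∞ z

  numer j : G → Carrier → Carrier
  numer (mat a b c d , _) z = ⟦ a ⟧ * z + ⟦ b ⟧
  j     (mat a b c d , _) z = ⟦ c ⟧ * z + ⟦ d ⟧

  infixr 7 _∙_
  _∙_ : G → Carrier → Carrier
  γ ∙ z = numer γ z * j γ z ⁻¹

  detᴳ : G → Carrier
  detᴳ (γ , _) = ⟦ det γ ⟧

  -- k-differentials φ(z)(dz)ᵏ on Ω are given by their coefficient φ.

  HasDerivative : (Carrier → Carrier) → Carrier → Carrier → Set (f ⊔ c ⊔ ℓ)
  HasDerivative g z D = ∀ r → ∃[ s ] ∀ w → w ∈Ω → w ≉ z → Close s w z →
    Close r ((g w - g z) * (w - z) ⁻¹) D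

  -- g*(φ(z)(dz)ᵏ) = ψ(z)(dz)ᵏ
  IsPullback : ℕ → (Carrier → Carrier) → (φ ψ : Carrier → Carrier) → Set (f ⊔ c ⊔ ℓ)
  IsPullback k g φ ψ = ∀ z → z ∈Ω →
    ∃[ D ] HasDerivative g z D × ψ z ≈ φ (g z) * D ^ k

  -- s(z;∞,0)ᵏ = (dz/z)ᵏ
  s∞0^ : ℕ → Carrier → Carrier
  s∞0^ k z = (z ⁻¹) ^ k

  ϱ-term : ℕ → Carrier → G → Carrier
  ϱ-term k z γ = detᴳ γ ^ k * (numer γ z ^ k * j γ z ^ k) ⁻¹

  Is-ϱ : ℕ → (Carrier → Carrier) → Set (f ⊔ ℓf ⊔ c)
  Is-ϱ k ϱ = ∀ z → z ∈Ω → HasSum G-setoid (ϱ-term k z) (ϱ z)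

  Is-e_A : (Carrier → Carrier) → Set (f ⊔ ℓf ⊔ c ⊔ ℓ)
  Is-e_A e = ∀ z → ∃[ p ]
    HasProduct A∖0-setoid (λ (b , _) → 1# - z * ⟦ b ⟧ ⁻¹) p × e z ≈ z * p

  module _ (e_A : Carrier → Carrier) where

    t_A : Carrier → Carrier
    t_A z = e_A z ⁻¹

    IsGossPolynomial : ℕ → Poly → Set (f ⊔ ℓf ⊔ c ⊔ ℓ)
    IsGossPolynomial n Gₙ = ∀ z → ¬ (∃[ b ] z ≈ ⟦ b ⟧) →
      HasSum A.setoid (λ b → ((z - ⟦ b ⟧) ^ n) ⁻¹) (eval Gₙ (t_A z))

    P-term : Poly → (w m : ℕ) → Carrier → G → Carrier
    P-term Gₙ w m z γ = (detᴳ γ ^ m * (j γ z ^ w) ⁻¹) * eval Gₙ (t_A (γ ∙ z))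

    -- P = P_{w,n}, where Gₙ is the n-th Goss polynomial; the exponent of
    -- det γ is a class modulo q - 1, hence any representative m is allowed.
    Is-P : Poly → (w n : ℕ) → (Carrier → Carrier) → Set (f ⊔ ℓf ⊔ c)
    Is-P Gₙ w n P = ∀ m → m ≡ n mod (q ℕ.∸ 1) →
      ∀ z → z ∈Ω → HasSum K\G-setoid (P-term Gₙ w m z) (P z)

{-# OPTIONS --safe #-}
module Submission where

-- Let z ∈ Ω, γ ∈ G and κ = ( α  −αβ ; 0 1 ) ∈ K. Then κγ has automorphy factor
-- j_γ(z), determinant α det γ, and acts on z by α (γz − β), so that α cancels in
-- the term of ϱ at κγ, which is det(γ)ᵏ j_γ(z)^(-2k) (γz − β)^(-k). Summing over β
-- gives the Goss polynomial at t_A(γz), and summing over the q − 1 units α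
-- multiplies by −1. For convergence, a finite set M of cosets is lifted to
-- the finite set of all κγ with γ ∈ M, α arbitrary and β in a finite B_γ ⊂ A large
-- enough both for the Goss sum at γz and for the prescribed finite part of G.

open import Algebra.Bundles using (CommutativeRing)
open import Algebra.Morphism.Structures using (IsRingHomomorphism)
import Algebra.Properties.AbelianGroup as AbelianGroupProperties
import Algebra.Properties.CommutativeMonoid.Sum as CommutativeMonoidSum
import Algebra.Properties.CommutativeSemiring.Exp as Exp
import Algebra.Properties.Group as GroupProperties
import Algebra.Properties.Ring as RingProperties
import Algebra.Properties.Semiring.Mult as Mult
import Algebra.Properties.Semiring.Mult.TCOptimised as MultTCO
import Algebra.Solver.Ring as RingSolver
open import Algebra.Solver.Ring.AlmostCommutativeRing
  using (_-Raw-AlmostCommutative⟶_; fromCommutativeRing)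
open import Data.Empty using (⊥-elim)
open import Data.Fin.Base as Fin using (Fin; punchIn; punchOut)
open import Data.Fin.Permutation using (Permutation′; permutation; _⟨$⟩ʳ_)
import Data.Fin.Properties as Fin
open import Data.Integer.Base as ℤ using (ℤ; +_; -[1+_]; _⊖_; _◃_; sign; ∣_∣)
import Data.Integer.Properties as ℤ
open import Data.List.Base
  using (List; []; _∷_; _++_; _∷ʳ_; map; foldr; concatMap; cartesianProductWith;
         length; upTo; allFin; deduplicate)
import Data.List.Membership.Setoid as Membership
import Data.List.Membership.Setoid.Properties as ∈
open import Data.List.Membership.Propositional.Properties using (∈-allFin)
open import Data.List.Properties using (length-tabulate; upTo-∷ʳ)
open import Data.List.Relation.Binary.Disjoint.Setoid using (Disjoint)
import Data.List.Relation.Binary.Subset.Setoid as Subset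
open import Data.List.Relation.Unary.All as All using (All; []; _∷_)
import Data.List.Relation.Unary.All.Properties as All
import Data.List.Relation.Unary.AllPairs as AllPairs
import Data.List.Relation.Unary.AllPairs.Properties as AllPairs
open import Data.List.Relation.Unary.Any as Any using (Any; here; there)
import Data.List.Relation.Unary.Unique.DecSetoid.Properties as UniqueDec
open import Data.List.Relation.Unary.Unique.Propositional.Properties using (allFin⁺)
open import Data.List.Relation.Unary.Unique.Setoid using (Unique)
import Data.List.Relation.Unary.Unique.Setoid.Properties as Unique
open import Data.Maybe.Base using (Maybe; just; nothing)
open import Data.Nat.Base as ℕ using (ℕ; zero; suc; z≤n; s≤s)
open import Data.Nat.Divisibility using (_∣_; divides)
import Data.Nat.Properties as ℕ
open import Data.Product.Base using (Σ-syntax; ∃-syntax; ∃₂; _×_; _,_; proj₁; proj₂)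
open import Data.Rational.Base as ℚ using (ℚ; 0ℚ; 1ℚ)
import Data.Rational.Properties as ℚ
open import Data.Rational.Solver using (module +-*-Solver)
import Data.Rational.Unnormalised.Base as ℚᵘ
import Data.Rational.Unnormalised.Properties as ℚᵘ
import Data.Sign.Base as Sign
open import Data.Sum.Base using (_⊎_; inj₁; inj₂)
open import Defs
open import Function.Base using (id)
open import Function.Bundles using (Inverse)
open import Level using (_⊔_)
open import Relation.Binary.Bundles using (Setoid; DecSetoid)
import Relation.Binary.Construct.Add.Supremum.NonStrict as Supremum
open import Relation.Binary.Core using (Rel)
open import Relation.Binary.Definitions using (Decidable)
open import Relation.Binary.PropositionalEquality.Core as ≡ using (_≡_; _≢_)
import Relation.Binary.PropositionalEquality.Properties as ≡
import Relation.Binary.Reasoning.Setoid as SetoidReasoning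
open import Relation.Binary.Structures using (IsEquivalence)
open import Relation.Nullary.Construct.Add.Supremum using ([_]; ⊤⁺; []-injective)
open import Relation.Nullary.Decidable.Core using (yes; no; map′)
open import Relation.Nullary.Negation.Core using (¬_; contradiction)
open Supremum ℚ._≤_ using ([_]; _≤⊤⁺; [≤]-injective; ≤⁺-trans)

-- Infinite sums are limits along finite sets, while every coset of K is infinite, so regrouping
-- needs an argument. Two facts make it work. By the ultrametric inequality errors do not add up, so
-- one precision can be imposed on all fibres, however many cosets M contains. And the finite set
-- that serves for ϱ serves, read modulo K, for the Poincaré series as well; hence the convergence
-- of the latter is a result and not an assumption.
--
-- The Goss polynomial may be applied at γz only if γz lies outside A, and the terms make sense only
-- if j_γ(z) is nonzero. Both come from the fact that cz + d, with c, d in A not both zero, has no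
-- zero in Ω, that is, from -d/c ∈ F∞. Since F∞ is given by explicit expansions in 1/T, the
-- expansion of a fraction has to be constructed, and long division does this.
--
-- The exponent of det γ is known only modulo q - 1. This is harmless because det γ is a unit of A,
-- hence a nonzero constant, and Fermat's theorem holds in 𝔽.

-- Ring identities with integer coefficients

module IntegerSolver {r ℓ} (R : CommutativeRing r ℓ) where
  open CommutativeRing R
  open RingProperties ring
  open AbelianGroupProperties +-abelianGroup using (⁻¹-∙-comm)
  open MultTCO semiring using (1+×; ×-homo-+; ×1-homo-*) renaming (_×_ to _×ₙ_)
  open SetoidReasoning setoid

  private
    -- With the optimised multiple, `fromℤ (+ 1)` reduces to `1#` instead of `1# + 0#`, so constants
    -- in solved equations match the goals by computation.
    fromℤ : ℤ → Carrier
    fromℤ (+ n)    = n ×ₙ 1#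
    fromℤ -[1+ n ] = - (suc n ×ₙ 1#)

    -- Integer multiplication is defined through sign and absolute value; `fromℤ-*` brings both
    -- sides into this form.
    signed : Sign.Sign → Carrier → Carrier
    signed Sign.+ x = x
    signed Sign.- x = - x

    cancel : ∀ x y → (1# + x) + - (1# + y) ≈ x + - y
    cancel x y = begin
      (1# + x) + - (1# + y)       ≈⟨ +-cong (+-comm 1# x) (sym (⁻¹-∙-comm 1# y)) ⟩
      (x + 1#) + (- 1# + - y)     ≈⟨ +-assoc x 1# _ ⟩
      x + (1# + (- 1# + - y))     ≈⟨ +-congˡ (+-assoc 1# (- 1#) (- y)) ⟨
      x + ((1# + - 1#) + - y)     ≈⟨ +-congˡ (+-congʳ (-‿inverseʳ 1#)) ⟩
      x + (0# + - y)              ≈⟨ +-congˡ (+-identityˡ _) ⟩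
      x + - y                     ∎

    fromℤ-⊖ : ∀ m n → fromℤ (m ⊖ n) ≈ m ×ₙ 1# + - (n ×ₙ 1#)
    fromℤ-⊖ m       zero    = sym (trans (+-congˡ -0#≈0#) (+-identityʳ _))
    fromℤ-⊖ zero    (suc n) = sym (+-identityˡ _)
    fromℤ-⊖ (suc m) (suc n) = begin
      fromℤ (suc m ⊖ suc n)           ≡⟨ ≡.cong fromℤ (ℤ.[1+m]⊖[1+n]≡m⊖n m n) ⟩
      fromℤ (m ⊖ n)                   ≈⟨ fromℤ-⊖ m n ⟩
      m ×ₙ 1# + - (n ×ₙ 1#)             ≈⟨ cancel _ _ ⟨
      (1# + m ×ₙ 1#) + - (1# + n ×ₙ 1#) ≈⟨ +-cong (1+× m 1#) (-‿cong (1+× n 1#)) ⟨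
      suc m ×ₙ 1# + - (suc n ×ₙ 1#)     ∎

    fromℤ-◃ : ∀ s n → fromℤ (s ◃ n) ≈ signed s (n ×ₙ 1#)
    fromℤ-◃ Sign.+ zero    = refl
    fromℤ-◃ Sign.- zero    = sym -0#≈0#
    fromℤ-◃ Sign.+ (suc n) = refl
    fromℤ-◃ Sign.- (suc n) = refl

    signed-* : ∀ s t x y → signed (s Sign.* t) (x * y) ≈ signed s x * signed t y
    signed-* Sign.+ Sign.+ x y = refl
    signed-* Sign.+ Sign.- x y = -‿distribʳ-* x y
    signed-* Sign.- Sign.+ x y = -‿distribˡ-* x y
    signed-* Sign.- Sign.- x y = sym (begin
      - x * - y      ≈⟨ -‿distribˡ-* x (- y) ⟨
      - (x * - y)    ≈⟨ -‿cong (-‿distribʳ-* x y) ⟨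
      - - (x * y)    ≈⟨ -‿involutive (x * y) ⟩
      x * y          ∎)

    signed-cong : ∀ s {x y} → x ≈ y → signed s x ≈ signed s y
    signed-cong Sign.+ e = e
    signed-cong Sign.- e = -‿cong e

    fromℤ-signed : ∀ i → fromℤ i ≈ signed (sign i) (∣ i ∣ ×ₙ 1#)
    fromℤ-signed (+ n)    = refl
    fromℤ-signed -[1+ n ] = refl

    fromℤ-+ : ∀ i j → fromℤ (i ℤ.+ j) ≈ fromℤ i + fromℤ j
    fromℤ-+ (+ m)    (+ n)    = ×-homo-+ 1# m n
    fromℤ-+ (+ m)    -[1+ n ] = fromℤ-⊖ m (suc n)
    fromℤ-+ -[1+ m ] (+ n)    = trans (fromℤ-⊖ n (suc m)) (+-comm _ _)
    fromℤ-+ -[1+ m ] -[1+ n ] = begin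
      - (suc (suc (m ℕ.+ n)) ×ₙ 1#)       ≡⟨ ≡.cong (λ k → - (suc k ×ₙ 1#)) (ℕ.+-suc m n) ⟨
      - ((suc m ℕ.+ suc n) ×ₙ 1#)         ≈⟨ -‿cong (×-homo-+ 1# (suc m) (suc n)) ⟩
      - (suc m ×ₙ 1# + suc n ×ₙ 1#)        ≈⟨ ⁻¹-∙-comm _ _ ⟨
      - (suc m ×ₙ 1#) + - (suc n ×ₙ 1#)    ∎

    fromℤ-* : ∀ i j → fromℤ (i ℤ.* j) ≈ fromℤ i * fromℤ j
    fromℤ-* i j = begin
      fromℤ (i ℤ.* j)
        ≈⟨ fromℤ-◃ (sign i Sign.* sign j) (∣ i ∣ ℕ.* ∣ j ∣) ⟩
      signed (sign i Sign.* sign j) ((∣ i ∣ ℕ.* ∣ j ∣) ×ₙ 1#)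
        ≈⟨ signed-cong (sign i Sign.* sign j) (×1-homo-* ∣ i ∣ ∣ j ∣) ⟩
      signed (sign i Sign.* sign j) ((∣ i ∣ ×ₙ 1#) * (∣ j ∣ ×ₙ 1#))
        ≈⟨ signed-* (sign i) (sign j) _ _ ⟩
      signed (sign i) (∣ i ∣ ×ₙ 1#) * signed (sign j) (∣ j ∣ ×ₙ 1#)
        ≈⟨ *-cong (fromℤ-signed i) (fromℤ-signed j) ⟨
      fromℤ i * fromℤ j ∎

    fromℤ-neg : ∀ i → fromℤ (ℤ.- i) ≈ - fromℤ i
    fromℤ-neg (+ zero)  = sym -0#≈0#
    fromℤ-neg (+ suc n) = refl
    fromℤ-neg -[1+ n ]  = sym (-‿involutive _)

    fromℤ-hom : ℤ.+-*-rawRing -Raw-AlmostCommutative⟶ fromCommutativeRing R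
    fromℤ-hom = record
      { ⟦_⟧    = fromℤ
      ; +-homo = fromℤ-+
      ; *-homo = fromℤ-*
      ; -‿homo = fromℤ-neg
      ; 0-homo = refl
      ; 1-homo = refl
      }

    coefficients≟ : ∀ i j → Maybe (fromℤ i ≈ fromℤ j)
    coefficients≟ i j with i ℤ.≟ j
    ... | yes ≡.refl = just refl
    ... | no _       = nothing

  open RingSolver ℤ.+-*-rawRing (fromCommutativeRing R) fromℤ-hom coefficients≟ public
    using (solve; _:=_; _:+_; _:*_; _:-_; :-_; con)

-- Inverses and powers in a field

module FieldProperties {c ℓ} (F : Field c ℓ) where
  open Field F
  open IntegerSolver commutativeRing
  open SetoidReasoning setoid

  *-cancelʳ-≉0 : ∀ {x y z} → z ≉ 0# → x * z ≈ y * z → x ≈ y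
  *-cancelʳ-≉0 {x} {y} {z} z≉0 e = begin
    x                ≈⟨ *-identityʳ x ⟨
    x * 1#           ≈⟨ *-congˡ (inverseʳ z≉0) ⟨
    x * (z * z ⁻¹)   ≈⟨ *-assoc _ _ _ ⟨
    (x * z) * z ⁻¹   ≈⟨ *-congʳ e ⟩
    (y * z) * z ⁻¹   ≈⟨ *-assoc _ _ _ ⟩
    y * (z * z ⁻¹)   ≈⟨ *-congˡ (inverseʳ z≉0) ⟩
    y * 1#           ≈⟨ *-identityʳ y ⟩
    y                ∎

  *-≉0 : ∀ {x y} → x ≉ 0# → y ≉ 0# → x * y ≉ 0#
  *-≉0 x≉0 y≉0 e = x≉0 (*-cancelʳ-≉0 y≉0 (trans e (sym (zeroˡ _))))

  ⁻¹-≉0 : ∀ {x} → x ≉ 0# → x ⁻¹ ≉ 0#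
  ⁻¹-≉0 x≉0 e = 1≉0 (trans (sym (inverseʳ x≉0)) (trans (*-congˡ e) (zeroʳ _)))

  inverseˡ : ∀ {x} → x ≉ 0# → x ⁻¹ * x ≈ 1#
  inverseˡ x≉0 = trans (*-comm _ _) (inverseʳ x≉0)

  ⁻¹-unique : ∀ {x y} → x * y ≈ 1# → y ≈ x ⁻¹
  ⁻¹-unique {x} {y} e =
    *-cancelʳ-≉0 x≉0 (trans (*-comm y x) (trans e (sym (inverseˡ x≉0))))
    where
    x≉0 : x ≉ 0#
    x≉0 x≈0 = 1≉0 (trans (sym e) (trans (*-congʳ x≈0) (zeroˡ y)))

  ⁻¹-distrib-* : ∀ {x y} → x ≉ 0# → y ≉ 0# → (x * y) ⁻¹ ≈ x ⁻¹ * y ⁻¹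
  ⁻¹-distrib-* {x} {y} x≉0 y≉0 = sym (⁻¹-unique (begin
    (x * y) * (x ⁻¹ * y ⁻¹)
      ≈⟨ solve 4 (λ x y x′ y′ → (x :* y) :* (x′ :* y′) := (x :* x′) :* (y :* y′)) refl _ _ _ _ ⟩
    (x * x ⁻¹) * (y * y ⁻¹)   ≈⟨ *-cong (inverseʳ x≉0) (inverseʳ y≉0) ⟩
    1# * 1#                   ≈⟨ *-identityˡ 1# ⟩
    1#                        ∎))

  ⁻¹-involutive : ∀ {x} → x ≉ 0# → x ⁻¹ ⁻¹ ≈ x
  ⁻¹-involutive x≉0 = sym (⁻¹-unique (inverseˡ x≉0))

  1^n≈1 : ∀ n → 1# ^ n ≈ 1#
  1^n≈1 zero    = refl
  1^n≈1 (suc n) = trans (*-identityˡ _) (1^n≈1 n)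

  ⁻¹-^ : ∀ {x} n → x ≉ 0# → (x ^ n) ⁻¹ ≈ (x ⁻¹) ^ n
  ⁻¹-^ {x} n x≉0 = sym (⁻¹-unique (begin
    x ^ n * (x ⁻¹) ^ n   ≈⟨ Exp.^-distrib-* commutativeSemiring x (x ⁻¹) n ⟨
    (x * x ⁻¹) ^ n       ≈⟨ Exp.^-congˡ commutativeSemiring n (inverseʳ x≉0) ⟩
    1# ^ n               ≈⟨ 1^n≈1 n ⟩
    1#                   ∎))

-- Valuations, ultrametric estimates and finite sums

x+x≡0⇒x≡0 : ∀ (x : ℚ) → x ℚ.+ x ≡ 0ℚ → x ≡ 0ℚ
x+x≡0⇒x≡0 x e with ℚ.≤-total x 0ℚ
... | inj₁ x≤0 = ℚ.≤-antisym x≤0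
  (≡.subst₂ ℚ._≤_ e (ℚ.+-identityʳ x) (ℚ.+-monoʳ-≤ x x≤0))
... | inj₂ 0≤x = ℚ.≤-antisym
  (≡.subst₂ ℚ._≤_ (ℚ.+-identityʳ x) e (ℚ.+-monoʳ-≤ x 0≤x)) 0≤x

x+y≡y⇒x≡0 : ∀ x y → x ℚ.+ y ≡ y → x ≡ 0ℚ
x+y≡y⇒x≡0 x y e = GroupProperties.∙-cancelʳ ℚ.+-0-group y x 0ℚ (≡.trans e (≡.sym (ℚ.+-identityˡ y)))

<⇒≱ : ∀ {x y} → x ℚ.< y → ¬ (y ℚ.≤ x)
<⇒≱ x<y y≤x = ℚ.<-irrefl ≡.refl (ℚ.<-≤-trans x<y y≤x)

module ValuedFieldProperties {c ℓ} (V : ValuedField c ℓ) where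
  open ValuedField V
  open FieldProperties asField public
  open IntegerSolver commutativeRing
  open RingProperties ring

  v-finite : ∀ {x} → x ≉ 0# → ∃[ t ] v x ≡ [ t ]
  v-finite {x} x≉0 with v x in eq
  ... | [ t ] = t , ≡.refl
  ... | ⊤⁺    = contradiction (v-definite eq) x≉0

  v-1 : v 1# ≡ [ 0ℚ ]
  v-1 with v-finite 1≉0
  ... | t , e = ≡.trans e (≡.cong [_] (x+y≡y⇒x≡0 t t ([]-injective (begin
    [ t ℚ.+ t ]      ≡⟨ ≡.cong₂ _+⁺_ e e ⟨
    v 1# +⁺ v 1#     ≡⟨ v-* 1# 1# ⟨
    v (1# * 1#)      ≡⟨ v-cong (*-identityˡ 1#) ⟩
    v 1#             ≡⟨ e ⟩
    [ t ]            ∎))))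
    where open ≡.≡-Reasoning

  v≡[]⇒≉0 : ∀ {x t} → v x ≡ [ t ] → x ≉ 0#
  v≡[]⇒≉0 e x≈0 with ≡.trans (≡.sym e) (≡.trans (v-cong x≈0) v-0)
  ... | ()

  v-⁻¹ : ∀ {x t} → v x ≡ [ t ] → v (x ⁻¹) ≡ [ ℚ.- t ]
  v-⁻¹ {x} {t} e with v-finite (⁻¹-≉0 (v≡[]⇒≉0 e))
  ... | s , e′ = ≡.trans e′ (≡.cong [_]
    (GroupProperties.inverseʳ-unique ℚ.+-0-group t s ([]-injective (begin
    [ t ℚ.+ s ]      ≡⟨ ≡.cong₂ _+⁺_ e e′ ⟨
    v x +⁺ v (x ⁻¹)  ≡⟨ v-* _ _ ⟨
    v (x * x ⁻¹)     ≡⟨ v-cong (inverseʳ (v≡[]⇒≉0 e)) ⟩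
    v 1#             ≡⟨ v-1 ⟩
    [ 0ℚ ]           ∎))))
    where open ≡.≡-Reasoning

  -- The square of -1 is 1, so twice its value is 0, and ℚ has no 2-torsion. This gives the
  -- invariance of `≼` under negation.
  v-⁻1 : v (- 1#) ≡ [ 0ℚ ]
  v-⁻1 with v-finite { - 1# } (λ e → 1≉0 (trans (sym (-‿involutive 1#)) (trans (-‿cong e) -0#≈0#)))
  ... | t , e = ≡.trans e (≡.cong [_] (x+x≡0⇒x≡0 t ([]-injective (begin
    [ t ℚ.+ t ]            ≡⟨ ≡.cong₂ _+⁺_ e e ⟨
    v (- 1#) +⁺ v (- 1#)   ≡⟨ v-* _ _ ⟨
    v (- 1# * - 1#)        ≡⟨ v-cong (trans (-1*x≈-x (- 1#)) (-‿involutive 1#)) ⟩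
    v 1#                   ≡⟨ v-1 ⟩
    [ 0ℚ ]                 ∎))))
    where open ≡.≡-Reasoning

  infix 4 _≼_
  _≼_ : ℚ → Carrier → Set
  r ≼ x = [ r ] ≤⁺ v x

  ≼-cong : ∀ {r x y} → x ≈ y → r ≼ x → r ≼ y
  ≼-cong {r} e = ≡.subst ([ r ] ≤⁺_) (v-cong e)

  ≼-0 : ∀ {r} → r ≼ 0#
  ≼-0 {r} = ≡.subst ([ r ] ≤⁺_) (≡.sym v-0) ([ r ] ≤⊤⁺)

  ≼-v : ∀ {x t} → v x ≡ [ t ] → t ≼ x
  ≼-v e = ≡.subst ([ _ ] ≤⁺_) (≡.sym e) [ ℚ.≤-refl ]

  v-≼ : ∀ {r x t} → v x ≡ [ t ] → r ≼ x → r ℚ.≤ t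
  v-≼ e p = [≤]-injective (≡.subst ([ _ ] ≤⁺_) e p)

  ≼-weaken : ∀ {r s x} → r ℚ.≤ s → s ≼ x → r ≼ x
  ≼-weaken r≤s = ≤⁺-trans ℚ.≤-trans [ r≤s ]

  ≼-+ : ∀ {r x y} → r ≼ x → r ≼ y → r ≼ x + y
  ≼-+ = v-ultrametric _ _

  ≼-* : ∀ {r s x y} → r ≼ x → s ≼ y → r ℚ.+ s ≼ x * y
  ≼-* {r} {s} {x} {y} p q = ≡.subst ([ r ℚ.+ s ] ≤⁺_) (≡.sym (v-* x y)) (+⁺-mono p q)
    where
    +⁺-mono : ∀ {r s a b} → [ r ] ≤⁺ a → [ s ] ≤⁺ b → [ r ℚ.+ s ] ≤⁺ a +⁺ b
    +⁺-mono [ p ]     [ q ]     = [ ℚ.+-mono-≤ p q ]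
    +⁺-mono [ p ]     (_ ≤⊤⁺)   = _ ≤⊤⁺
    +⁺-mono (_ ≤⊤⁺)   q         = _ ≤⊤⁺

  ≼-- : ∀ {r x} → r ≼ x → r ≼ - x
  ≼-- {r} {x} p = ≼-cong (-1*x≈-x x)
    (≡.subst (_≼ - 1# * x) (ℚ.+-identityˡ r) (≼-* (≼-v v-⁻1) p))

  ≼-cancelʳ : ∀ {r x y t} → v y ≡ [ t ] → r ℚ.+ t ≼ x * y → r ≼ x
  ≼-cancelʳ {r} {x} {y} {t} e p = ≼-cong
    (trans (*-assoc x y (y ⁻¹)) (trans (*-congˡ (inverseʳ (v≡[]⇒≉0 e))) (*-identityʳ x)))
    (≡.subst (_≼ (x * y) * y ⁻¹) (r+t-t≡r r t) (≼-* p (≼-v (v-⁻¹ e))))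
    where
    r+t-t≡r : ∀ r t → (r ℚ.+ t) ℚ.+ ℚ.- t ≡ r
    r+t-t≡r r t = ≡.trans (ℚ.+-assoc r t (ℚ.- t))
      (≡.trans (≡.cong (r ℚ.+_) (ℚ.+-inverseʳ t)) (ℚ.+-identityʳ r))

  -- The isosceles principle. Each of x and y is the other one corrected by x - y, and a correction
  -- of value above t cannot affect a value equal to t.
  v-close : ∀ {s t x y} → v y ≡ [ t ] → t ℚ.< s → s ≼ x - y → v x ≡ [ t ]
  v-close {s} {t} {x} {y} e t<s p with v x in eq
  ... | ⊤⁺    = contradiction (v-≼ e (≼-cong lemma (≼-+ x≼ (≼-- p)))) (<⇒≱ t<s)
    where
    x≼ : s ≼ x
    x≼ = ≼-cong (sym (v-definite eq)) ≼-0
    lemma : x + - (x - y) ≈ y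
    lemma = solve 2 (λ x y → x :+ :- (x :- y) := y) refl x y
  ... | [ u ] = ≡.cong [_] (ℚ.≤-antisym u≤t t≤u)
    where
    t≤u : t ℚ.≤ u
    t≤u = v-≼ eq (≼-cong (solve 2 (λ x y → y :+ (x :- y) := x) refl x y)
                         (≼-+ (≼-v e) (≼-weaken (ℚ.<⇒≤ t<s) p)))
    u≤t : u ℚ.≤ t
    u≤t with ℚ.≤-total u s
    ... | inj₁ u≤s = v-≼ e (≼-cong (solve 2 (λ x y → x :+ :- (x :- y) := y) refl x y)
                         (≼-+ (≼-v eq) (≼-- (≼-weaken u≤s p))))
    ... | inj₂ s≤u = contradiction
      (v-≼ e (≼-cong (solve 2 (λ x y → x :+ :- (x :- y) := y) refl x y)
                         (≼-+ (≼-weaken s≤u (≼-v eq)) (≼-- p))))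
      (<⇒≱ t<s)

  *-continuous : ∀ a r → ∃[ s ] ∀ {x} → s ≼ x → r ≼ a * x
  *-continuous a r with v a in eq
  -- Here a = 0 and every product vanishes, so any radius serves.
  ... | ⊤⁺    = 0ℚ , λ {x} _ → ≼-cong (sym (trans (*-congʳ (v-definite eq)) (zeroˡ x))) ≼-0
  ... | [ t ] = r ℚ.- t , λ {x} p → ≡.subst (_≼ a * x) t+r-t≡r (≼-* (≼-v eq) p)
    where
    t+r-t≡r : t ℚ.+ (r ℚ.- t) ≡ r
    t+r-t≡r = ≡.trans (ℚ.+-comm t _) (≡.trans (ℚ.+-assoc r (ℚ.- t) t)
      (≡.trans (≡.cong (r ℚ.+_) (ℚ.+-inverseˡ t)) (ℚ.+-identityʳ r)))

  Close-cong : ∀ {r x x′ y y′} → x ≈ x′ → y ≈ y′ → Close r x y → Close r x′ y′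
  Close-cong e f = ≼-cong (+-cong e (-‿cong f))

  Close-+ : ∀ {r x x′ y y′} → Close r x y → Close r x′ y′ → Close r (x + x′) (y + y′)
  Close-+ {r} {x} {x′} {y} {y′} p q = ≼-cong
    (solve 4 (λ x y x′ y′ → (x :- y) :+ (x′ :- y′) := (x :+ x′) :- (y :+ y′)) refl x y x′ y′)
    (≼-+ p q)

  Close-- : ∀ {r x y} → Close r x y → Close r (- x) (- y)
  Close-- {r} {x} {y} p = ≼-cong
    (solve 2 (λ x y → :- (x :- y) := :- x :- :- y) refl x y) (≼-- p)

  Close-refl : ∀ {r x} → Close r x x
  Close-refl {r} {x} = ≼-cong (sym (-‿inverseʳ x)) ≼-0

  Close-sym : ∀ {r x y} → Close r x y → Close r y x
  Close-sym {r} {x} {y} p = ≼-cong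
    (solve 2 (λ x y → :- (x :- y) := y :- x) refl x y) (≼-- p)

  Close-trans : ∀ {r x y z} → Close r x y → Close r y z → Close r x z
  Close-trans {r} {x} {y} {z} p q = ≼-cong
    (solve 3 (λ x y z → (x :- y) :+ (y :- z) := x :- z) refl x y z) (≼-+ p q)

  sumMap : ∀ {i} {I : Set i} → (I → Carrier) → List I → Carrier
  sumMap f xs = foldr _+_ 0# (map f xs)

  -- By the ultrametric inequality the error is independent of the length of the list.
  Close-sumMap : ∀ {i} {I : Set i} {f g : I → Carrier} {r} →
    (∀ x → Close r (f x) (g x)) → ∀ xs → Close r (sumMap f xs) (sumMap g xs)
  Close-sumMap p []       = Close-refl
  Close-sumMap p (x ∷ xs) = Close-+ (p x) (Close-sumMap p xs)

  sumMap-cong : ∀ {i} {I : Set i} {f g : I → Carrier} →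
    (∀ x → f x ≈ g x) → ∀ xs → sumMap f xs ≈ sumMap g xs
  sumMap-cong e []       = refl
  sumMap-cong e (x ∷ xs) = +-cong (e x) (sumMap-cong e xs)

  sumMap-++ : ∀ {i} {I : Set i} (f : I → Carrier) xs ys →
    sumMap f (xs ++ ys) ≈ sumMap f xs + sumMap f ys
  sumMap-++ f []       ys = sym (+-identityˡ _)
  sumMap-++ f (x ∷ xs) ys = trans (+-congˡ (sumMap-++ f xs ys)) (sym (+-assoc _ _ _))

  sumMap-concatMap : ∀ {i j} {I : Set i} {J : Set j} (f : J → Carrier) (g : I → List J) xs →
    sumMap f (concatMap g xs) ≈ sumMap (λ x → sumMap f (g x)) xs
  sumMap-concatMap f g []       = refl
  sumMap-concatMap f g (x ∷ xs) =
    trans (sumMap-++ f (g x) (concatMap g xs)) (+-congˡ (sumMap-concatMap f g xs))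

  sumMap-* : ∀ {i} {I : Set i} a (f : I → Carrier) xs →
    sumMap (λ x → a * f x) xs ≈ a * sumMap f xs
  sumMap-* a f []       = sym (zeroʳ a)
  sumMap-* a f (x ∷ xs) = trans (+-congˡ (sumMap-* a f xs)) (sym (distribˡ _ _ _))

  sumMap-- : ∀ {i} {I : Set i} (f : I → Carrier) xs →
    sumMap (λ x → - f x) xs ≈ - sumMap f xs
  sumMap-- f []       = sym -0#≈0#
  sumMap-- f (x ∷ xs) = trans (+-congˡ (sumMap-- f xs))
    (solve 2 (λ a b → :- a :+ :- b := :- (a :+ b)) refl _ _)

  sumMap-map : ∀ {i j} {I : Set i} {J : Set j} (f : J → Carrier) (g : I → J) xs →
    sumMap f (map g xs) ≡ sumMap (λ x → f (g x)) xs
  sumMap-map f g []       = ≡.refl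
  sumMap-map f g (x ∷ xs) = ≡.cong (λ y → f (g x) + y) (sumMap-map f g xs)

  sumMap-cartesianProductWith : ∀ {i j k} {I : Set i} {J : Set j} {K : Set k}
    (f : K → Carrier) (g : I → J → K) xs ys →
    sumMap f (cartesianProductWith g xs ys) ≈ sumMap (λ x → sumMap (λ y → f (g x y)) ys) xs
  sumMap-cartesianProductWith f g []       ys = refl
  sumMap-cartesianProductWith f g (x ∷ xs) ys = trans
    (sumMap-++ f (map (g x) ys) _)
    (+-cong (reflexive (sumMap-map f (g x) ys)) (sumMap-cartesianProductWith f g xs ys))

  hasSum-* : ∀ {i ℓᵢ} (I : Setoid i ℓᵢ) a {f : Setoid.Carrier I → Carrier} {s} →
    HasSum I f s → HasSum I (λ x → a * f x) (a * s)
  hasSum-* I a {f} {s} f-sum r with *-continuous a r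
  ... | r′ , small with f-sum r′
  ...   | L , close = L , λ M M! L⊆M → ≼-cong
    (trans (solve 3 (λ a x s → a :* (x :- s) := a :* x :- a :* s) refl a _ s)
      (+-congʳ (sym (sumMap-* a f M))))
    (small (close M M! L⊆M))

-- Sums over a quotient set, computed fibre by fibre

-- The classes of the coarser relation ≈ᵠ are parametrised by Fin n × A, via rep γ.
module Fibration
  {x ℓ₁ ℓ₂ a ℓₐ} {X : Set x} {_≈_ : Rel X ℓ₁} {_≈ᵠ_ : Rel X ℓ₂}
  (≈-isEquivalence : IsEquivalence _≈_) (≈ᵠ-isEquivalence : IsEquivalence _≈ᵠ_)
  (A-decSetoid : DecSetoid a ℓₐ) {n : ℕ}
  (rep : X → Fin n → DecSetoid.Carrier A-decSetoid → X)
  (rep-cong : ∀ γ {i i′ β β′} → i ≡ i′ → DecSetoid._≈_ A-decSetoid β β′ →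
    rep γ i β ≈ rep γ i′ β′)
  (rep-injective : ∀ γ {i i′ β β′} → rep γ i β ≈ rep γ i′ β′ →
    i ≡ i′ × DecSetoid._≈_ A-decSetoid β β′)
  (rep-coset : ∀ γ δ i i′ β β′ → rep γ i β ≈ rep δ i′ β′ → γ ≈ᵠ δ)
  (rep-surjective : ∀ γ δ → γ ≈ᵠ δ → ∃₂ λ i β → δ ≈ rep γ i β)
  where

  X-setoid : Setoid x ℓ₁
  X-setoid = record { isEquivalence = ≈-isEquivalence }

  Q-setoid : Setoid x ℓ₂
  Q-setoid = record { isEquivalence = ≈ᵠ-isEquivalence }

  private
    module A = DecSetoid A-decSetoid
    module X = Setoid X-setoid
    module Q = Setoid Q-setoid
    module ∈A = Membership A.setoid
    module ∈X = Membership X-setoid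
    module ∈Q = Membership Q-setoid

  -- Only β is recorded, because `reps` runs through all of `Fin n` anyway, whereas β has to be put
  -- into a finite list.
  Covers : A.Carrier → X → List X → Set (x ⊔ ℓ₁)
  Covers β δ M = Any (λ γ → ∃[ i ] δ ≈ rep γ i β) M

  covering : ∀ {δ M} → δ ∈Q.∈ M → ∃[ β ] Covers β δ M
  covering (here δ≈γ) with rep-surjective _ _ (Q.sym δ≈γ)
  ... | i , β , e = β , here (i , e)
  covering (there p) with covering p
  ... | β , q = β , there q

  -- One list B is shared by all representatives in M, so that nobody has to track which class an
  -- element of L belongs to.
  coverings : ∀ {M} L → All (∈Q._∈ M) L →
    ∃[ B ] All (λ δ → ∃[ β ] β ∈A.∈ B × Covers β δ M) L
  coverings []      []       = [] , []
  coverings (δ ∷ L) (p ∷ ps) with covering p | coverings L ps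
  ... | β , q | B , qs = β ∷ B ,
    (β , here A.refl , q) ∷ All.map (λ (β′ , β′∈B , q′) → β′ , there β′∈B , q′) qs

  module _ (B : X → List A.Carrier) where

    reps : X → List X
    reps γ = cartesianProductWith (rep γ) (allFin n) (B γ)

    ∈-reps⁻ : ∀ {γ δ} → δ ∈X.∈ reps γ → ∃₂ λ i β → δ ≈ rep γ i β
    ∈-reps⁻ {γ} δ∈
      with ∈.∈-cartesianProductWith⁻ (≡.setoid (Fin n)) A.setoid X-setoid
             (rep γ) (allFin n) (B γ) δ∈
    ... | i , β , _ , _ , e = i , β , e

    -- Within a class `rep-injective` excludes repetitions. Between two classes `rep-coset` does: a
    -- common element would make two representatives in M equivalent.
    reps-unique : (∀ γ → Unique A.setoid (B γ)) →
      ∀ {M} → Unique Q-setoid M → Unique X-setoid (concatMap reps M)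
    reps-unique B! {M} M! = Unique.concat⁺ X-setoid
      (All.map⁺ (All.universal (λ γ →
        Unique.cartesianProductWith⁺ (≡.setoid (Fin n)) A.setoid X-setoid (rep γ)
          (rep-injective γ) (allFin⁺ n) (B! γ)) M))
      (AllPairs.map⁺ (AllPairs.map disjoint M!))
      where
      disjoint : ∀ {γ δ} → ¬ (γ ≈ᵠ δ) → Disjoint X-setoid (reps γ) (reps δ)
      disjoint {γ} {δ} γ≉δ (ε∈γ , ε∈δ)
        with ∈-reps⁻ {γ} ε∈γ | ∈-reps⁻ {δ} ε∈δ
      ... | _ , _ , e | _ , _ , e′ = γ≉δ (rep-coset γ δ _ _ _ _ (X.trans (X.sym e) e′))

    ∈-reps⁺ : ∀ {γ δ i β} → β ∈A.∈ B γ → δ ≈ rep γ i β → δ ∈X.∈ reps γ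
    ∈-reps⁺ {γ} {i = i} β∈B e = ∈.∈-resp-≈ X-setoid (X.sym e)
      (∈.∈-cartesianProductWith⁺ (≡.setoid (Fin n)) A.setoid X-setoid
        (rep-cong γ) (∈-allFin i) β∈B)

    ∈-concatMap-reps : ∀ {β δ M} → (∀ γ → β ∈A.∈ B γ) → Covers β δ M →
      δ ∈X.∈ concatMap reps M
    ∈-concatMap-reps β∈B p = ∈.∈-concatMap⁺ (≡.setoid X) X-setoid
      (Any.map (λ {γ} (_ , e) → ∈-reps⁺ (β∈B γ) e) p)

  module _ {c ℓ} (V : ValuedField c ℓ) where
    open ValuedField V using (Carrier; -_; HasSum; Close; ring)
      renaming (_≈_ to _≋_; refl to ≋-refl; trans to ≋-trans)
    open ValuedFieldProperties V

    hasSum-fibres : ∀ {f : X → Carrier} {h : X → A.Carrier → Carrier} {P : X → Carrier} {s} →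
      (∀ γ i β → f (rep γ i β) ≋ h γ β) →
      (∀ y → sumMap (λ _ → y) (allFin n) ≋ - y) →
      (∀ γ → HasSum A.setoid (h γ) (P γ)) →
      HasSum X-setoid f s → HasSum Q-setoid P (- s)
    hasSum-fibres {f} {h} {P} {s} f≈h sum-const h-sum f-sum r with f-sum r
    -- The list for f is reused, now read modulo `≈ᵠ`: the inclusion in M says that each of its
    -- elements lies in a class listed in M.
    ... | L , f-close = L , close
      where
      close : ∀ M → Unique Q-setoid M → Subset._⊆_ Q-setoid L M → Close r (sumMap P M) (- s)
      close M M! L⊆M with coverings L (All.tabulateₛ Q-setoid L⊆M)
      -- The sum of P over M is within r of the double sum of h; by `total` this is minus the sum of
      -- f over S, which is within r of -s.
      ... | B₀ , covers = Close-trans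
        (Close-sym (Close-sumMap (λ γ →
          proj₂ (h-sum γ r) (B γ) (B! γ) (λ β∈ → ++⊆B γ (∈.∈-++⁺ˡ A.setoid β∈))) M))
        (Close-cong (RingProperties.-‿involutive ring _) ≋-refl
          (Close-- (Close-cong total ≋-refl (f-close S (reps-unique B B! M!) L⊆S))))
        where
        -- Limits along finite sets only see lists without repetition, so the overlap of the two
        -- lists must be removed; this requires decidable equality on A.
        B : X → List A.Carrier
        B γ = deduplicate A._≟_ (proj₁ (h-sum γ r) ++ B₀)
        B! : ∀ γ → Unique A.setoid (B γ)
        B! γ = UniqueDec.deduplicate-! A-decSetoid (proj₁ (h-sum γ r) ++ B₀)
        ++⊆B : ∀ γ {β} → β ∈A.∈ (proj₁ (h-sum γ r) ++ B₀) → β ∈A.∈ B γ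
        ++⊆B γ = ∈.∈-deduplicate⁺ A.setoid A._≟_ (λ e f → A.trans f (A.sym e))
        S : List X
        S = concatMap (reps B) M
        respects : ∀ {δ δ′} → δ ≈ δ′ → (∃[ β ] β ∈A.∈ B₀ × Covers β δ M) →
          ∃[ β ] β ∈A.∈ B₀ × Covers β δ′ M
        respects δ≈δ′ (β , β∈B₀ , p) = β , β∈B₀ ,
          Any.map (λ (i , e) → i , X.trans (X.sym δ≈δ′) e) p
        L⊆S : Subset._⊆_ X-setoid L S
        L⊆S δ∈L with All.lookupₛ X-setoid respects covers δ∈L
        ... | β , β∈B₀ , p = ∈-concatMap-reps B
          (λ γ → ++⊆B γ (∈.∈-++⁺ʳ A.setoid (proj₁ (h-sum γ r)) β∈B₀)) p
        total : sumMap f S ≋ - sumMap (λ γ → sumMap (h γ) (B γ)) M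
        total = ≋-trans (sumMap-concatMap f (reps B) M) (≋-trans
          (sumMap-cong (λ γ → ≋-trans (sumMap-cartesianProductWith f (rep γ) (allFin n) (B γ))
            (≋-trans (sumMap-cong (λ i → sumMap-cong (f≈h γ i) (B γ)) (allFin n)) (sum-const _))) M)
          (sumMap-- _ M))

-- Natural numbers as values

-- Defined by recursion so that a factor T or 1/T corresponds to one unfolding.
natℚ : ℕ → ℚ
natℚ zero    = 0ℚ
natℚ (suc n) = 1ℚ ℚ.+ natℚ n

0≤natℚ : ∀ n → 0ℚ ℚ.≤ natℚ n
0≤natℚ zero    = ℚ.≤-refl
0≤natℚ (suc n) = ℚ.+-mono-≤ {0ℚ} {1ℚ} (ℚ.nonNegative⁻¹ 1ℚ) (0≤natℚ n)

0<natℚ-suc : ∀ n → 0ℚ ℚ.< natℚ (suc n)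
0<natℚ-suc n = ℚ.+-mono-<-≤ {0ℚ} {1ℚ} (ℚ.positive⁻¹ 1ℚ) (0≤natℚ n)

natℚ-mono : ∀ {m n} → m ℕ.≤ n → natℚ m ℚ.≤ natℚ n
natℚ-mono {n = n} z≤n = 0≤natℚ n
natℚ-mono {suc m} {suc n} (s≤s p) = ℚ.+-monoʳ-≤ 1ℚ (natℚ-mono p)

-natℚ-suc : ∀ n → ℚ.- 1ℚ ℚ.+ ℚ.- natℚ n ≡ ℚ.- natℚ (suc n)
-natℚ-suc n = ≡.sym (ℚ.neg-distrib-+ 1ℚ (natℚ n))

-natℚ-suc<0 : ∀ n → ℚ.- natℚ (suc n) ℚ.< 0ℚ
-natℚ-suc<0 n = ℚ.neg-antimono-< (0<natℚ-suc n)

toℚᵘ-natℚ : ∀ n → ℚ.toℚᵘ (natℚ n) ℚᵘ.≃ ℚᵘ.mkℚᵘ (+ n) 0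
toℚᵘ-natℚ zero    = ℚᵘ.≃-refl
toℚᵘ-natℚ (suc n) = ℚᵘ.≃-trans (ℚ.toℚᵘ-homo-+ 1ℚ (natℚ n))
  (ℚᵘ.≃-trans (ℚᵘ.+-congʳ ℚᵘ.1ℚᵘ (toℚᵘ-natℚ n)) (ℚᵘ.*≡* (≡.cong (ℤ._* + 1) (begin
    + 1 ℤ.+ + n ℤ.* + 1   ≡⟨ ≡.cong (λ i → + 1 ℤ.+ i) (ℤ.*-identityʳ (+ n)) ⟩
    + suc n               ∎))))
  where open ≡.≡-Reasoning

-- A nonnegative fraction is at most its numerator, as the denominator is at least 1; a negative one
-- is at most 0.
archimedean : ∀ r → ∃[ n ] r ℚ.≤ natℚ n
archimedean r@(ℚ.mkℚ (+ m) d _) = m , ℚ.toℚᵘ-cancel-≤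
  (ℚᵘ.≤-respʳ-≃ (ℚᵘ.≃-sym (toℚᵘ-natℚ m)) (ℚᵘ.*≤* (ℤ.*-monoˡ-≤-nonNeg (+ m) (ℤ.+≤+ (s≤s z≤n)))))
archimedean r@(ℚ.mkℚ -[1+ m ] d _) = 0 , ℚ.toℚᵘ-cancel-≤ (ℚᵘ.*≤* ℤ.-≤+)

-- Decidable equality and degrees over a finite field

module FiniteFieldProperties {f ℓf q} (𝔽 : FiniteField f ℓf q) where
  open FiniteField 𝔽
  open FieldProperties asField public
  open Polynomial commutativeRing
  open Inverse enumeration public using () renaming (to to index; from to element)

  element-index : ∀ x → element (index x) ≈ x
  element-index x = Inverse.inverseʳ enumeration ≡.refl

  index-element : ∀ i → index (element i) ≡ i
  index-element i = Inverse.inverseˡ enumeration refl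

  index-injective : ∀ {x y} → index x ≡ index y → x ≈ y
  index-injective {x} {y} e =
    trans (sym (element-index x)) (trans (reflexive (≡.cong element e)) (element-index y))

  infix 4 _≈?_ _≋?_
  _≈?_ : Decidable _≈_
  x ≈? y = map′ index-injective (Inverse.to-cong enumeration) (index x Fin.≟ index y)

  _≋?_ : Decidable _≋_
  []      ≋? []      = yes ≋-refl
  []      ≋? (b ∷ q) with 0# ≈? b | [] ≋? q
  ... | yes e | yes f = yes (≋-trans (≋-sym 0∷[]≋[]) (∷-cong e f))
  ... | no ¬e | _     = no λ e → ¬e (e .at 0)
  ... | _     | no ¬f = no λ f → ¬f (mk λ n → f .at (suc n))
  (a ∷ p) ≋? []      with a ≈? 0# | p ≋? []
  ... | yes e | yes f = yes (≋-trans (∷-cong e f) 0∷[]≋[])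
  ... | no ¬e | _     = no λ e → ¬e (e .at 0)
  ... | _     | no ¬f = no λ f → ¬f (mk λ n → f .at (suc n))
  (a ∷ p) ≋? (b ∷ q) with a ≈? b | p ≋? q
  ... | yes e | yes f = yes (∷-cong e f)
  ... | no ¬e | _     = no λ e → ¬e (e .at 0)
  ... | _     | no ¬f = no λ f → ¬f (mk λ n → f .at (suc n))

  VanishesAbove : ℕ → Poly → Set ℓf
  VanishesAbove d p = ∀ n → d ℕ.< n → coeff p n ≈ 0#

  HasDegree : Poly → ℕ → Set ℓf
  HasDegree p d = coeff p d ≉ 0# × VanishesAbove d p

  degree : ∀ p → p ≋ [] ⊎ ∃[ d ] HasDegree p d
  degree []      = inj₁ ≋-refl
  degree (a ∷ p) with degree p
  ... | inj₂ (d , l≉0 , above) = inj₂ (suc d , l≉0 , λ { (suc n) (s≤s d<n) → above n d<n })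
  ... | inj₁ p≋[] with a ≈? 0#
  ...   | yes a≈0 = inj₁ (≋-trans (∷-cong a≈0 p≋[]) 0∷[]≋[])
  ...   | no  a≉0 = inj₂ (0 , a≉0 , λ { (suc n) _ → p≋[] .at n })

  coeff-beyond : ∀ p n → length p ℕ.≤ n → coeff p n ≈ 0#
  coeff-beyond []      n       _       = refl
  coeff-beyond (a ∷ p) (suc n) (s≤s l) = coeff-beyond p n l

  -- Multiplication by the n-th power of T, used to lift the degree of a denominator above that of
  -- the numerator.
  shift : ℕ → Poly → Poly
  shift zero    p = p
  shift (suc n) p = 0# ∷ shift n p

  shift-degree : ∀ N {p d} → HasDegree p d → HasDegree (shift N p) (N ℕ.+ d)
  shift-degree zero    h = h
  shift-degree (suc N) h with shift-degree N h
  ... | l≉0 , above = l≉0 , λ { (suc n) (s≤s d<n) → above n d<n }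

-- Evaluation at T, and expansion of fractions in 1/T

module Evaluation {f ℓf q} {𝔽 : FiniteField f ℓf q} {c ℓ} (ℂ∞ : CInfinity 𝔽 c ℓ) where
  open CInfinity ℂ∞
  open Drinfeld ℂ∞ using (⟦_⟧)
  open ValuedFieldProperties valuedField
  open IntegerSolver commutativeRing
  open SetoidReasoning setoid
  open FiniteFieldProperties 𝔽
    using (HasDegree; VanishesAbove; degree; shift; shift-degree; coeff-beyond)
  private
    module 𝔽 = FiniteField 𝔽
    module P = Polynomial 𝔽.commutativeRing
    module A = CommutativeRing P.polynomialRing
    module ι = IsRingHomomorphism ι-hom
  open P using (_≋_; _⊕_; _⊗_; ⊝_; _·_; const; at; mk)

  ⟦⟧-≋[] : ∀ p → p ≋ [] → ⟦ p ⟧ ≈ 0#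
  ⟦⟧-≋[] []      e = refl
  ⟦⟧-≋[] (a ∷ p) e = begin
    ι a + T * ⟦ p ⟧   ≈⟨ +-cong (trans (ι.⟦⟧-cong (e .at 0)) ι.0#-homo)
                                (*-congˡ (⟦⟧-≋[] p (mk λ n → e .at (suc n)))) ⟩
    0# + T * 0#       ≈⟨ trans (+-identityˡ _) (zeroʳ T) ⟩
    0#                ∎

  ⟦⟧-⊕ : ∀ p q → ⟦ p ⊕ q ⟧ ≈ ⟦ p ⟧ + ⟦ q ⟧
  ⟦⟧-⊕ []      q       = sym (+-identityˡ _)
  ⟦⟧-⊕ (a ∷ p) []      = sym (+-identityʳ _)
  ⟦⟧-⊕ (a ∷ p) (b ∷ q) = begin
    ι (a 𝔽.+ b) + T * ⟦ p ⊕ q ⟧          ≈⟨ +-cong (ι.+-homo a b) (*-congˡ (⟦⟧-⊕ p q)) ⟩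
    (ι a + ι b) + T * (⟦ p ⟧ + ⟦ q ⟧)    ≈⟨ solve 5 (λ a b t p q →
       (a :+ b) :+ t :* (p :+ q) := (a :+ t :* p) :+ (b :+ t :* q)) refl _ _ _ _ _ ⟩
    (ι a + T * ⟦ p ⟧) + (ι b + T * ⟦ q ⟧) ∎

  ⟦⟧-⊝ : ∀ p → ⟦ ⊝ p ⟧ ≈ - ⟦ p ⟧
  ⟦⟧-⊝ []      = sym (RingProperties.-0#≈0# ring)
  ⟦⟧-⊝ (a ∷ p) = begin
    ι (𝔽.- a) + T * ⟦ ⊝ p ⟧   ≈⟨ +-cong (ι.-‿homo a) (*-congˡ (⟦⟧-⊝ p)) ⟩
    - ι a + T * - ⟦ p ⟧
      ≈⟨ solve 3 (λ a t p → :- a :+ t :* :- p := :- (a :+ t :* p)) refl _ _ _ ⟩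
    - (ι a + T * ⟦ p ⟧)       ∎

  ⟦⟧-· : ∀ a p → ⟦ a · p ⟧ ≈ ι a * ⟦ p ⟧
  ⟦⟧-· a []      = sym (zeroʳ _)
  ⟦⟧-· a (b ∷ p) = begin
    ι (a 𝔽.* b) + T * ⟦ a · p ⟧   ≈⟨ +-cong (ι.*-homo a b) (*-congˡ (⟦⟧-· a p)) ⟩
    ι a * ι b + T * (ι a * ⟦ p ⟧)
      ≈⟨ solve 4 (λ a b t p → a :* b :+ t :* (a :* p) := a :* (b :+ t :* p)) refl _ _ _ _ ⟩
    ι a * (ι b + T * ⟦ p ⟧)       ∎

  ⟦⟧-0∷ : ∀ p → ⟦ 𝔽.0# ∷ p ⟧ ≈ T * ⟦ p ⟧
  ⟦⟧-0∷ p = trans (+-congʳ ι.0#-homo) (+-identityˡ _)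

  ⟦⟧-⊗ : ∀ p q → ⟦ p ⊗ q ⟧ ≈ ⟦ p ⟧ * ⟦ q ⟧
  ⟦⟧-⊗ []      q = sym (zeroˡ _)
  ⟦⟧-⊗ (a ∷ p) q = begin
    ⟦ a · q ⊕ (𝔽.0# ∷ p ⊗ q) ⟧         ≈⟨ ⟦⟧-⊕ (a · q) _ ⟩
    ⟦ a · q ⟧ + ⟦ 𝔽.0# ∷ p ⊗ q ⟧
      ≈⟨ +-cong (⟦⟧-· a q) (trans (⟦⟧-0∷ (p ⊗ q)) (*-congˡ (⟦⟧-⊗ p q))) ⟩
    ι a * ⟦ q ⟧ + T * (⟦ p ⟧ * ⟦ q ⟧)
      ≈⟨ solve 4 (λ a t p q → a :* q :+ t :* (p :* q) := (a :+ t :* p) :* q) refl _ _ _ _ ⟩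
    (ι a + T * ⟦ p ⟧) * ⟦ q ⟧          ∎

  ⟦⟧-constant : ∀ a p → p ≋ [] → ⟦ a ∷ p ⟧ ≈ ι a
  ⟦⟧-constant a p p≋[] =
    trans (+-congˡ (trans (*-congˡ (⟦⟧-≋[] p p≋[])) (zeroʳ T))) (+-identityʳ _)

  ⟦⟧-const : ∀ a → ⟦ const a ⟧ ≈ ι a
  ⟦⟧-const a = ⟦⟧-constant a [] P.≋-refl

  ⟦⟧-1 : ⟦ A.1# ⟧ ≈ 1#
  ⟦⟧-1 = trans (⟦⟧-const 𝔽.1#) ι.1#-homo

  -- Equal polynomials may be lists of different lengths. Passing to the difference leaves an
  -- induction on a single list, `⟦⟧-≋[]`.
  ⟦⟧-cong : ∀ {p q} → p ≋ q → ⟦ p ⟧ ≈ ⟦ q ⟧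
  ⟦⟧-cong {p} {q} e = begin
    ⟦ p ⟧                      ≈⟨ solve 2 (λ p q → p := (p :+ :- q) :+ q) refl _ _ ⟩
    (⟦ p ⟧ + - ⟦ q ⟧) + ⟦ q ⟧  ≈⟨ +-congʳ (+-congˡ (⟦⟧-⊝ q)) ⟨
    (⟦ p ⟧ + ⟦ ⊝ q ⟧) + ⟦ q ⟧  ≈⟨ +-congʳ (⟦⟧-⊕ p (⊝ q)) ⟨
    ⟦ p ⊕ ⊝ q ⟧ + ⟦ q ⟧
      ≈⟨ +-congʳ (⟦⟧-≋[] (p ⊕ ⊝ q) (A.trans (P.⊕-cong e P.≋-refl) (P.⊝-inverseʳ q))) ⟩
    0# + ⟦ q ⟧                 ≈⟨ +-identityˡ _ ⟩
    ⟦ q ⟧                      ∎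

  0≼ι : ∀ a → 0ℚ ≼ ι a
  0≼ι a with FiniteFieldProperties._≈?_ 𝔽 a 𝔽.0#
  ... | yes a≈0 = ≼-cong (sym (trans (ι.⟦⟧-cong a≈0) ι.0#-homo)) ≼-0
  ... | no  a≉0 = ≼-v (v-ι a≉0)

  ≼-⟦⟧ : ∀ d p → VanishesAbove d p → ℚ.- natℚ d ≼ ⟦ p ⟧
  ≼-⟦⟧ d       []      _     = ≼-0
  ≼-⟦⟧ zero    (a ∷ p) above = ≼-cong
    (sym (⟦⟧-constant a p (mk λ n → above (suc n) (s≤s z≤n)))) (0≼ι a)
  ≼-⟦⟧ (suc d) (a ∷ p) above = ≼-+
    (≼-weaken (ℚ.<⇒≤ (-natℚ-suc<0 d)) (0≼ι a))
    (≡.subst (_≼ T * ⟦ p ⟧) (-natℚ-suc d)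
      (≼-* (≼-v v-T) (≼-⟦⟧ d p λ n d<n → above (suc n) (s≤s d<n))))

  -- In Horner form, T times the tail has value -(d + 1) < 0 while the constant term has value at
  -- least 0, so the isosceles principle applies.
  v-⟦⟧ : ∀ d p → HasDegree p d → v ⟦ p ⟧ ≡ [ ℚ.- natℚ d ]
  v-⟦⟧ d       []      (l≉0 , _)     = contradiction 𝔽.refl l≉0
  v-⟦⟧ zero    (a ∷ p) (l≉0 , above) = ≡.trans
    (v-cong (⟦⟧-constant a p (mk λ n → above (suc n) (s≤s z≤n))))
    (v-ι l≉0)
  v-⟦⟧ (suc d) (a ∷ p) (l≉0 , above) = v-close
    (≡.trans (v-* T ⟦ p ⟧) (≡.trans
      (≡.cong₂ _+⁺_ v-T (v-⟦⟧ d p (l≉0 , λ n d<n → above (suc n) (s≤s d<n))))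
      (≡.cong [_] (-natℚ-suc d))))
    (-natℚ-suc<0 d)
    (≼-cong (solve 2 (λ a x → a := (a :+ x) :- x) refl _ _) (0≼ι a))

  T≉0 : T ≉ 0#
  T≉0 = v≡[]⇒≉0 v-T

  ≼-T^ : ∀ n → ℚ.- natℚ n ≼ T ^ n
  ≼-T^ zero    = ≼-v v-1
  ≼-T^ (suc n) = ≡.subst (_≼ T * T ^ n) (-natℚ-suc n) (≼-* (≼-v v-T) (≼-T^ n))

  ≼-T⁻¹^ : ∀ n → natℚ n ≼ (T ⁻¹) ^ n
  ≼-T⁻¹^ zero    = ≼-v v-1
  ≼-T⁻¹^ (suc n) = ≼-* (≼-v (v-⁻¹ v-T)) (≼-T⁻¹^ n)

  ⟦⟧-shift : ∀ N p → ⟦ shift N p ⟧ ≈ T ^ N * ⟦ p ⟧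
  ⟦⟧-shift zero    p = sym (*-identityˡ _)
  ⟦⟧-shift (suc N) p =
    trans (⟦⟧-0∷ (shift N p)) (trans (*-congˡ (⟦⟧-shift N p)) (sym (*-assoc _ _ _)))

  -- A multiple of 1/Q is expanded in powers of 1/T: cancel the coefficient of T^D in
  -- the numerator, then multiply by T.
  module LongDivision (Q : P.Poly) (D : ℕ) (Q-degree : HasDegree Q D) where

    quotient : P.Poly → 𝔽.Carrier
    quotient p = P.coeff p D 𝔽.* P.coeff Q D 𝔽.⁻¹

    step : P.Poly → P.Poly
    step p = 𝔽.0# ∷ p ⊕ ⊝ (quotient p · Q)

    remainder : P.Poly → ℕ → P.Poly
    remainder p zero    = p
    remainder p (suc n) = step (remainder p n)

    digit : P.Poly → ℕ → 𝔽.Carrier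
    digit p n = quotient (remainder p n)

    -- The factor T moves the coefficient at D to D + 1, where the subtraction has just made it
    -- zero; beyond that, both p and Q vanish.
    step-vanishes : ∀ p → VanishesAbove D p → VanishesAbove D (step p)
    step-vanishes p above (suc n) (s≤s D≤n) = 𝔽.trans expand (go (ℕ.m≤n⇒m<n∨m≡n D≤n))
      where
      expand : P.coeff (p ⊕ ⊝ (quotient p · Q)) n 𝔽.≈
               P.coeff p n 𝔽.+ 𝔽.- (quotient p 𝔽.* P.coeff Q n)
      expand = 𝔽.trans (P.coeff-⊕ p _ n) (𝔽.+-congˡ (𝔽.trans (P.coeff-⊝ (quotient p · Q) n)
        (𝔽.-‿cong (P.coeff-· (quotient p) Q n))))
      go : D ℕ.< n ⊎ D ≡ n →
        P.coeff p n 𝔽.+ 𝔽.- (quotient p 𝔽.* P.coeff Q n) 𝔽.≈ 𝔽.0#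
      go (inj₁ D<n) = 𝔽.trans
        (𝔽.+-cong (above n D<n) (𝔽.-‿cong (𝔽.trans (𝔽.*-congˡ (proj₂ Q-degree n D<n)) (𝔽.zeroʳ _))))
        (𝔽.-‿inverseʳ 𝔽.0#)
      go (inj₂ ≡.refl) = 𝔽.trans
        (𝔽.+-congˡ (𝔽.-‿cong (𝔽.trans (𝔽.*-assoc _ _ _)
          (𝔽.trans (𝔽.*-congˡ (FiniteFieldProperties.inverseˡ 𝔽 (proj₁ Q-degree)))
            (𝔽.*-identityʳ _)))))
        (𝔽.-‿inverseʳ _)

    remainder-vanishes : ∀ p n → VanishesAbove D p → VanishesAbove D (remainder p n)
    remainder-vanishes p zero    above = above
    remainder-vanishes p (suc n) above =
      step-vanishes (remainder p n) (remainder-vanishes p n above)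

    ⟦⟧-step : ∀ p → ⟦ step p ⟧ ≈ T * (⟦ p ⟧ - ι (quotient p) * ⟦ Q ⟧)
    ⟦⟧-step p = trans (⟦⟧-0∷ (p ⊕ ⊝ (quotient p · Q))) (*-congˡ (trans (⟦⟧-⊕ p (⊝ (quotient p · Q)))
      (+-congˡ (trans (⟦⟧-⊝ (quotient p · Q)) (-‿cong (⟦⟧-· (quotient p) Q))))))

    laurentSum-suc : ∀ N a n →
      laurentSum N a (suc n) ≈ laurentSum N a n + ι (a n) * (T ^ N * (T ⁻¹) ^ n)
    laurentSum-suc N a n = begin
      sumMap g (upTo (suc n))    ≡⟨ ≡.cong (sumMap g) (upTo-∷ʳ n) ⟨
      sumMap g (upTo n ∷ʳ n)     ≈⟨ sumMap-++ g (upTo n) (n ∷ []) ⟩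
      sumMap g (upTo n) + (g n + 0#)   ≈⟨ +-congˡ (+-identityʳ _) ⟩
      sumMap g (upTo n) + g n    ∎
      where g = λ i → ι (a i) * (T ^ N * (T ⁻¹) ^ i)

    -- Each digit takes its multiple of Q away from the remainder. Inserting `T ⁻¹ * T` turns what
    -- is left into the next remainder, since `step` multiplies by T.
    laurentSum-quotient : ∀ N p n → laurentSum N (digit p) n * ⟦ Q ⟧ ≈
      T ^ N * (⟦ p ⟧ - (T ⁻¹) ^ n * ⟦ remainder p n ⟧)
    laurentSum-quotient N p zero = begin
      0# * ⟦ Q ⟧
        ≈⟨ solve 3 (λ q t p → con (+ 0) :* q := t :* (p :- con (+ 1) :* p)) refl _ _ _ ⟩
      T ^ N * (⟦ p ⟧ - 1# * ⟦ p ⟧)       ∎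
    laurentSum-quotient N p (suc n) = begin
      laurentSum N (digit p) (suc n) * ⟦ Q ⟧
        ≈⟨ *-congʳ (laurentSum-suc N (digit p) n) ⟩
      (laurentSum N (digit p) n + ι a * (T ^ N * (T ⁻¹) ^ n)) * ⟦ Q ⟧
        ≈⟨ distribʳ _ _ _ ⟩
      laurentSum N (digit p) n * ⟦ Q ⟧ + ι a * (T ^ N * (T ⁻¹) ^ n) * ⟦ Q ⟧
        ≈⟨ +-congʳ (laurentSum-quotient N p n) ⟩
      T ^ N * (⟦ p ⟧ - (T ⁻¹) ^ n * ⟦ remainder p n ⟧) + ι a * (T ^ N * (T ⁻¹) ^ n) * ⟦ Q ⟧
        ≈⟨ solve 6 (λ t p s ρ a Q → t :* (p :- s :* ρ) :+ a :* (t :* s) :* Q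
             := t :* (p :- s :* (ρ :- a :* Q))) refl (T ^ N) _ _ _ _ _ ⟩
      T ^ N * (⟦ p ⟧ - (T ⁻¹) ^ n * (⟦ remainder p n ⟧ - ι a * ⟦ Q ⟧))
        ≈⟨ *-congˡ (+-congˡ (-‿cong (trans (sym (trans (*-congʳ (inverseˡ T≉0)) (*-identityˡ _)))
             (solve 4 (λ t t′ s x → (t′ :* t) :* (s :* x)
                  := (t′ :* s) :* (t :* x)) refl T (T ⁻¹) _ _)))) ⟩
      T ^ N * (⟦ p ⟧ - (T ⁻¹) ^ suc n * (T * (⟦ remainder p n ⟧ - ι a * ⟦ Q ⟧)))
        ≈⟨ *-congˡ (+-congˡ (-‿cong (*-congˡ (⟦⟧-step (remainder p n))))) ⟨
      T ^ N * (⟦ p ⟧ - (T ⁻¹) ^ suc n * ⟦ remainder p (suc n) ⟧) ∎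
      where a = digit p n

    laurentSum-converges : ∀ N p x → VanishesAbove D p →
      x * ⟦ Q ⟧ ≈ T ^ N * ⟦ p ⟧ → Converges (laurentSum N (digit p)) x
    -- Q has value -D and every remainder has value at least -D, so the error has value at least n -
    -- N; hence n ≥ r + N suffices.
    laurentSum-converges N p x above e r with archimedean (r ℚ.+ natℚ N)
    ... | n₀ , r+N≤n₀ = n₀ , λ n n₀≤n → ≼-cancelʳ (v-⟦⟧ D Q Q-degree)
      (≼-weaken (bound n n₀≤n) (≼-cong (error n) (≼-- (≼-* (≼-T^ N)
        (≼-* (≼-T⁻¹^ n) (≼-⟦⟧ D (remainder p n) (remainder-vanishes p n above)))))))
      where
      error : ∀ n → - (T ^ N * ((T ⁻¹) ^ n * ⟦ remainder p n ⟧)) ≈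
        (laurentSum N (digit p) n - x) * ⟦ Q ⟧
      error n = sym (begin
        (laurentSum N (digit p) n - x) * ⟦ Q ⟧
          ≈⟨ solve 3 (λ l x q → (l :- x) :* q := l :* q :- x :* q) refl _ _ _ ⟩
        laurentSum N (digit p) n * ⟦ Q ⟧ - x * ⟦ Q ⟧
          ≈⟨ +-cong (laurentSum-quotient N p n) (-‿cong e) ⟩
        T ^ N * (⟦ p ⟧ - (T ⁻¹) ^ n * ⟦ remainder p n ⟧) - T ^ N * ⟦ p ⟧
          ≈⟨ solve 4 (λ t p s ρ → t :* (p :- s :* ρ) :- t :* p
               := :- (t :* (s :* ρ))) refl (T ^ N) _ _ _ ⟩
        - (T ^ N * ((T ⁻¹) ^ n * ⟦ remainder p n ⟧)) ∎)
      bound : ∀ n → n₀ ℕ.≤ n → r ℚ.+ ℚ.- natℚ D ℚ.≤ ℚ.- natℚ N ℚ.+ (natℚ n ℚ.+ ℚ.- natℚ D)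
      bound n n₀≤n = ≡.subst₂ ℚ._≤_
        (Q.solve 3 (λ r N D → (r Q.:+ N) Q.:+ (Q.:- N Q.:+ Q.:- D) Q.:= r Q.:+ Q.:- D)
          ≡.refl r (natℚ N) (natℚ D))
        (Q.solve 3 (λ n N D → n Q.:+ (Q.:- N Q.:+ Q.:- D) Q.:= Q.:- N Q.:+ (n Q.:+ Q.:- D))
          ≡.refl (natℚ n) (natℚ N) (natℚ D))
        (ℚ.+-monoˡ-≤ (ℚ.- natℚ N ℚ.+ ℚ.- natℚ D) (ℚ.≤-trans r+N≤n₀ (natℚ-mono n₀≤n)))
        where module Q = +-*-Solver

  -- Long division needs a numerator of degree at most that of the denominator. Multiplying s by
  -- T^N, with N the length of p, achieves this, and the same T^N reappears as the leading power of
  -- the Laurent sum.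
  fraction∈F∞ : ∀ p s x → ¬ (s ≋ []) → x * ⟦ s ⟧ ≈ ⟦ p ⟧ → InF∞ x
  fraction∈F∞ p s x s≉0 e with degree s
  ... | inj₁ s≋[]    = contradiction s≋[] s≉0
  ... | inj₂ (d , h) = N , digit p , laurentSum-converges N p x
    (λ n N+d<n → coeff-beyond p n (ℕ.≤-trans (ℕ.m≤m+n N d) (ℕ.<⇒≤ N+d<n)))
    (begin
      x * ⟦ shift N s ⟧     ≈⟨ *-congˡ (⟦⟧-shift N s) ⟩
      x * (T ^ N * ⟦ s ⟧)
        ≈⟨ solve 3 (λ x t s → x :* (t :* s) := t :* (x :* s)) refl x (T ^ N) ⟦ s ⟧ ⟩
      T ^ N * (x * ⟦ s ⟧)   ≈⟨ *-congˡ e ⟩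
      T ^ N * ⟦ p ⟧         ∎)
    where
    N = length p
    open LongDivision (shift N s) (N ℕ.+ d) (shift-degree N h)

  -- Additivity of degrees is read off from the multiplicative valuation at T: the value of the
  -- product, 0, is minus the sum of the two degrees, so u has degree 0.
  unit⇒const : ∀ u y → u ⊗ y ≋ A.1# → ∃[ α ] α 𝔽.≉ 𝔽.0# × u ≋ const α
  unit⇒const u y e with degree u | degree y
  ... | inj₁ u≋[] | _ = contradiction
          (A.trans (A.sym e) (A.trans (A.*-congʳ u≋[]) (A.zeroˡ y)) .at 0) 𝔽.1≉0
  ... | _ | inj₁ y≋[] = contradiction
          (A.trans (A.sym e) (A.trans (A.*-congˡ {u} y≋[]) (A.zeroʳ u)) .at 0) 𝔽.1≉0
  ... | inj₂ (zero , l≉0 , above) | inj₂ _ = P.coeff u 0 , l≉0 ,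
          mk λ { zero → 𝔽.refl ; (suc n) → above (suc n) (s≤s z≤n) }
  ... | inj₂ (suc d , hu) | inj₂ (e′ , hy) = contradiction
    ([]-injective (≡.trans (≡.sym (≡.cong₂ _+⁺_ (v-⟦⟧ (suc d) u hu) (v-⟦⟧ e′ y hy)))
      (≡.trans (≡.sym (v-* ⟦ u ⟧ ⟦ y ⟧))
        (≡.trans (v-cong (trans (sym (⟦⟧-⊗ u y)) (trans (⟦⟧-cong e) ⟦⟧-1))) v-1))))
    (ℚ.<⇒≢ (ℚ.+-mono-<-≤ (-natℚ-suc<0 d) (ℚ.neg-antimono-≤ (0≤natℚ e′))))

-- Units of a finite field: characteristic and Fermat's theorem

module FiniteFieldUnits {f ℓf n} (𝔽 : FiniteField f ℓf (suc n)) where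
  open FiniteField 𝔽
  open FiniteFieldProperties 𝔽
  open RingProperties ring using (+-cancelˡ)
  open IntegerSolver commutativeRing
  open Mult semiring using () renaming (_×_ to _×ₙ_)
  private
    module ∑ = CommutativeMonoidSum +-commutativeMonoid
    module ∏ = CommutativeMonoidSum *-commutativeMonoid

  -- Skipping the index of `0#` enumerates the nonzero elements; with q = `suc n` there are n of
  -- them.
  unit : Fin n → Carrier
  unit j = element (punchIn (index 0#) j)

  index-cong : ∀ {x y} → x ≈ y → index x ≡ index y
  index-cong = Inverse.to-cong enumeration

  unit≉0 : ∀ j → unit j ≉ 0#
  unit≉0 j e = Fin.punchInᵢ≢i (index 0#) j
    (≡.trans (≡.sym (index-element _)) (index-cong e))

  unit-injective : ∀ {i j} → unit i ≈ unit j → i ≡ j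
  unit-injective {i} {j} e = Fin.punchIn-injective (index 0#) i j
    (≡.trans (≡.sym (index-element _)) (≡.trans (index-cong e) (index-element _)))

  unit-surjective : ∀ {x} → x ≉ 0# → ∃[ j ] unit j ≈ x
  unit-surjective {x} x≉0 = punchOut i≢j ,
    trans (reflexive (≡.cong element (Fin.punchIn-punchOut i≢j))) (element-index x)
    where
    i≢j : index 0# ≢ index x
    i≢j e = x≉0 (sym (index-injective e))

  -- Translation by 1 permutes 𝔽, so adding q × 1 does not change the sum of 𝔽.
  q×1≈0 : suc n ×ₙ 1# ≈ 0#
  q×1≈0 = +-cancelˡ (∑.sum element) _ _ (sym (begin
    ∑.sum element + 0#                          ≈⟨ +-identityʳ _ ⟩
    ∑.sum element                               ≈⟨ ∑.sum-permute element π ⟩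
    ∑.sum (λ i → element (π ⟨$⟩ʳ i))
      ≈⟨ ∑.sum-cong-≋ (λ i → element-index (element i + 1#)) ⟩
    ∑.sum (λ i → element i + 1#)                ≈⟨ ∑.∑-distrib-+ element (λ _ → 1#) ⟩
    ∑.sum element + ∑.sum {suc n} (λ _ → 1#)    ≈⟨ +-congˡ (∑.sum-replicate (suc n)) ⟩
    ∑.sum element + suc n ×ₙ 1#                 ∎))
    where
    open SetoidReasoning setoid
    shiftBy : Carrier → Fin (suc n) → Fin (suc n)
    shiftBy a i = index (element i + a)
    inverse : ∀ a b → a + b ≈ 0# → ∀ i → shiftBy a (shiftBy b i) ≡ i
    inverse a b e i = ≡.trans (index-cong (begin
      element (index (element i + b)) + a   ≈⟨ +-congʳ (element-index _) ⟩
      (element i + b) + a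
        ≈⟨ solve 3 (λ x a b → (x :+ b) :+ a := x :+ (a :+ b)) refl _ a b ⟩
      element i + (a + b)                   ≈⟨ +-congˡ e ⟩
      element i + 0#                        ≈⟨ +-identityʳ _ ⟩
      element i                             ∎)) (index-element i)
    π : Permutation′ (suc n)
    π = permutation (shiftBy 1#) (shiftBy (- 1#))
      (inverse 1# (- 1#) (-‿inverseʳ 1#)) (inverse (- 1#) 1# (-‿inverseˡ 1#))

  ∏≉0 : ∀ {m} (t : Fin m → Carrier) → (∀ i → t i ≉ 0#) → ∏.sum t ≉ 0#
  ∏≉0 {zero}  t t≉0 = 1≉0
  ∏≉0 {suc m} t t≉0 = *-≉0 (t≉0 Fin.zero) (∏≉0 (λ i → t (Fin.suc i)) (λ i → t≉0 (Fin.suc i)))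

  -- Multiplication by a permutes the units, so it leaves their product unchanged while contributing
  -- the factor `a ^ n`; the product is nonzero and cancels.
  fermat : ∀ {a} → a ≉ 0# → a ^ n ≈ 1#
  fermat {a} a≉0 = *-cancelʳ-≉0 (∏≉0 unit unit≉0) (begin
    a ^ n * ∏.sum unit                   ≈⟨ *-congʳ (∏.sum-replicate n) ⟨
    ∏.sum {n} (λ _ → a) * ∏.sum unit     ≈⟨ ∏.∑-distrib-+ (λ _ → a) unit ⟨
    ∏.sum (λ j → a * unit j)             ≈⟨ ∏.sum-cong-≋ (λ j → proj₂ (scaled a a≉0 j)) ⟨
    ∏.sum (λ j → unit (π ⟨$⟩ʳ j))        ≈⟨ ∏.sum-permute unit π ⟨
    ∏.sum unit                           ≈⟨ *-identityˡ _ ⟨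
    1# * ∏.sum unit                      ∎)
    where
    open SetoidReasoning setoid
    scaled : ∀ b → b ≉ 0# → ∀ j → ∃[ i ] unit i ≈ b * unit j
    scaled b b≉0 j = unit-surjective (*-≉0 b≉0 (unit≉0 j))
    inverse : ∀ b c (b≉0 : b ≉ 0#) (c≉0 : c ≉ 0#) → b * c ≈ 1# → ∀ j →
      proj₁ (scaled b b≉0 (proj₁ (scaled c c≉0 j))) ≡ j
    inverse b c b≉0 c≉0 e j = unit-injective (begin
      unit (proj₁ (scaled b b≉0 (proj₁ (scaled c c≉0 j))))
        ≈⟨ proj₂ (scaled b b≉0 _) ⟩
      b * unit (proj₁ (scaled c c≉0 j))   ≈⟨ *-congˡ (proj₂ (scaled c c≉0 j)) ⟩
      b * (c * unit j)                    ≈⟨ *-assoc _ _ _ ⟨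
      (b * c) * unit j                    ≈⟨ *-congʳ e ⟩
      1# * unit j                         ≈⟨ *-identityˡ _ ⟩
      unit j                              ∎)
    π : Permutation′ n
    π = permutation (λ j → proj₁ (scaled a a≉0 j)) (λ j → proj₁ (scaled (a ⁻¹) (⁻¹-≉0 a≉0) j))
      (inverse a (a ⁻¹) a≉0 (⁻¹-≉0 a≉0) (inverseʳ a≉0))
      (inverse (a ⁻¹) a (⁻¹-≉0 a≉0) a≉0 (inverseˡ a≉0))

-- Affine matrices acting from the left

module MatrixProperties {r ℓ} (R : CommutativeRing r ℓ) where
  open CommutativeRing R
  open Matrices R
  open IntegerSolver R
  open SetoidReasoning setoid

  det-affine : ∀ u β γ → det (affine u β *ₘ γ) ≈ u * det γ
  det-affine u β (mat a b c d) = solve 6 (λ u β a b c d →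
    (u :* a :+ β :* c) :* (con (+ 0) :* b :+ con (+ 1) :* d) :-
    (u :* b :+ β :* d) :* (con (+ 0) :* a :+ con (+ 1) :* c)
    := u :* (a :* d :- b :* c)) refl u β a b c d

  -- The top row of the product is u (a, b) + β (c, d). Cramer's rule recovers u and β from it,
  -- because `det γ` is a unit.
  affine-injective : ∀ {u u′ β β′} γ → IsUnit (det γ) →
    affine u β *ₘ γ ≈ₘ affine u′ β′ *ₘ γ → u ≈ u′ × β ≈ β′
  affine-injective {u} {u′} {β} {β′} (mat a b c d) (y , Δy≈1) (mat≈ p q _ _) =
    cramer (solve₁ u β) (solve₁ u′ β′) (+-cong (*-congʳ p) (-‿cong (*-congʳ q))) ,
    cramer (solve₂ u β) (solve₂ u′ β′) (+-cong (*-congʳ q) (-‿cong (*-congʳ p)))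
    where
    cramer : ∀ {x x′ w w′} → w ≈ x * (a * d - b * c) → w′ ≈ x′ * (a * d - b * c) →
      w ≈ w′ → x ≈ x′
    cramer {x} {x′} {w} {w′} e e′ f = trans (sym (scale x e)) (trans (*-congʳ f) (scale x′ e′))
      where
      scale : ∀ x {w} → w ≈ x * (a * d - b * c) → w * y ≈ x
      scale x e = trans (*-congʳ e) (trans (*-assoc _ _ _) (trans (*-congˡ Δy≈1) (*-identityʳ x)))
    solve₁ : ∀ u β → (u * a + β * c) * d - (u * b + β * d) * c ≈ u * (a * d - b * c)
    solve₁ u β = solve 6 (λ u β a b c d → (u :* a :+ β :* c) :* d :- (u :* b :+ β :* d) :* c
      := u :* (a :* d :- b :* c)) refl u β a b c d
    solve₂ : ∀ u β → (u * b + β * d) * a - (u * a + β * c) * b ≈ β * (a * d - b * c)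
    solve₂ u β = solve 6 (λ u β a b c d → (u :* b :+ β :* d) :* a :- (u :* a :+ β :* c) :* b
      := β :* (a :* d :- b :* c)) refl u β a b c d

  rows≉0 : 1# ≉ 0# → ∀ γ → IsUnit (det γ) →
    ¬ (M₂.a γ ≈ 0# × M₂.b γ ≈ 0#) × ¬ (M₂.c γ ≈ 0# × M₂.d γ ≈ 0#)
  rows≉0 1≉0 (mat a b c d) (y , Δy≈1) = (λ (a≈0 , b≈0) → absurd (begin
      a * d - b * c      ≈⟨ +-cong (*-congʳ a≈0) (-‿cong (*-congʳ b≈0)) ⟩
      0# * d - 0# * c
        ≈⟨ solve 2 (λ c d → con (+ 0) :* d :- con (+ 0) :* c := con (+ 0)) refl c d ⟩
      0#                 ∎)) , (λ (c≈0 , d≈0) → absurd (begin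
      a * d - b * c      ≈⟨ +-cong (*-congˡ d≈0) (-‿cong (*-congˡ c≈0)) ⟩
      a * 0# - b * 0#
        ≈⟨ solve 2 (λ a b → a :* con (+ 0) :- b :* con (+ 0) := con (+ 0)) refl a b ⟩
      0#                 ∎))
    where
    absurd : ¬ (a * d - b * c ≈ 0#)
    absurd e = 1≉0 (trans (sym Δy≈1) (trans (*-congʳ e) (zeroˡ y)))

  rep-unit : ∀ {α α⁻¹ y} β γ → α * α⁻¹ ≈ 1# → det γ * y ≈ 1# →
    det (affine α (- (α * β)) *ₘ γ) * (α⁻¹ * y) ≈ 1#
  rep-unit {α} {α⁻¹} {y} β γ αα⁻¹≈1 Δy≈1 = begin
    det (affine α (- (α * β)) *ₘ γ) * (α⁻¹ * y)
      ≈⟨ *-congʳ (det-affine α _ γ) ⟩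
    (α * det γ) * (α⁻¹ * y)
      ≈⟨ solve 4 (λ α Δ α⁻¹ y → (α :* Δ) :* (α⁻¹ :* y)
           := (α :* α⁻¹) :* (Δ :* y)) refl α (det γ) α⁻¹ y ⟩
    (α * α⁻¹) * (det γ * y)
      ≈⟨ *-cong αα⁻¹≈1 Δy≈1 ⟩
    1# * 1#
      ≈⟨ *-identityˡ 1# ⟩
    1# ∎

  -- Together with `-[u*x]-surjective`, this makes β ↦ -uβ a bijection, which trades the upper right
  -- entry of an element of K for the parameter β of `rep`.
  -[u*x]-injective : ∀ {u u⁻¹ x y} → u * u⁻¹ ≈ 1# → - (u * x) ≈ - (u * y) → x ≈ y
  -[u*x]-injective {u} {u⁻¹} {x} {y} uu⁻¹≈1 e =
    trans (sym (scale x)) (trans (*-congˡ (-‿cong e)) (scale y))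
    where
    scale : ∀ x → u⁻¹ * (- (- (u * x))) ≈ x
    scale x = begin
      u⁻¹ * (- (- (u * x)))
        ≈⟨ solve 3 (λ u u⁻¹ x → u⁻¹ :* (:- (:- (u :* x))) := (u :* u⁻¹) :* x) refl u u⁻¹ x ⟩
      (u * u⁻¹) * x          ≈⟨ *-congʳ uu⁻¹≈1 ⟩
      1# * x                 ≈⟨ *-identityˡ x ⟩
      x                      ∎

  -[u*x]-surjective : ∀ {u u⁻¹} x → u * u⁻¹ ≈ 1# → x ≈ - (u * (- (u⁻¹ * x)))
  -[u*x]-surjective {u} {u⁻¹} x uu⁻¹≈1 = begin
    x                         ≈⟨ *-identityˡ x ⟨
    1# * x                    ≈⟨ *-congʳ uu⁻¹≈1 ⟨
    (u * u⁻¹) * x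
      ≈⟨ solve 3 (λ u u⁻¹ x → (u :* u⁻¹) :* x := :- (u :* (:- (u⁻¹ :* x)))) refl u u⁻¹ x ⟩
    - (u * (- (u⁻¹ * x)))     ∎

  *ₘ-affine-cong : ∀ {u u′ β β′} γ → u ≈ u′ → β ≈ β′ → affine u β *ₘ γ ≈ₘ affine u′ β′ *ₘ γ
  *ₘ-affine-cong γ e f =
    mat≈ (+-cong (*-congʳ e) (*-congʳ f)) (+-cong (*-congʳ e) (*-congʳ f)) refl refl

-- The action on Ω and the pullback of dz/z

module HalfPlane {f ℓf q} {𝔽 : FiniteField f ℓf q} {c ℓ} (ℂ∞ : CInfinity 𝔽 c ℓ) where
  open CInfinity ℂ∞
  open Arithmetic 𝔽
  open Drinfeld ℂ∞
  open Evaluation ℂ∞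
  open ValuedFieldProperties valuedField
  open IntegerSolver commutativeRing
  open SetoidReasoning setoid
  open Exp commutativeSemiring using (^-congˡ; ^-distrib-*)
  open FiniteFieldProperties 𝔽 using (degree)
  private
    module 𝔽 = FiniteField 𝔽
    module A = CommutativeRing A-ring

  -- If c is nonzero, a zero z would be the fraction -d/c, which lies in F∞. If c = 0, then d is
  -- nonzero and its evaluation has a finite value.
  linear≉0 : ∀ {z} c d → z ∈Ω → ¬ (c A.≈ A.0# × d A.≈ A.0#) → ⟦ c ⟧ * z + ⟦ d ⟧ ≉ 0#
  linear≉0 {z} c d z∈Ω cd≉0 e with degree c | degree d
  ... | inj₂ (n , l≉0 , _) | _ = z∈Ω (fraction∈F∞ (A.- d) c z
    (λ c≋[] → l≉0 (c≋[] .Polynomial.at n)) (begin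
    z * ⟦ c ⟧
      ≈⟨ solve 3 (λ z c d → z :* c := (c :* z :+ d) :- d) refl z _ ⟦ d ⟧ ⟩
    (⟦ c ⟧ * z + ⟦ d ⟧) - ⟦ d ⟧      ≈⟨ +-congʳ e ⟩
    0# - ⟦ d ⟧                       ≈⟨ +-identityˡ _ ⟩
    - ⟦ d ⟧                          ≈⟨ ⟦⟧-⊝ d ⟨
    ⟦ A.- d ⟧                        ∎))
  ... | inj₁ c≋[] | inj₁ d≋[]    = cd≉0 (c≋[] , d≋[])
  ... | inj₁ c≋[] | inj₂ (n , h) = v≡[]⇒≉0 (v-⟦⟧ n d h) (begin
    ⟦ d ⟧               ≈⟨ solve 2 (λ z d → d := con (+ 0) :* z :+ d) refl z _ ⟩
    0# * z + ⟦ d ⟧      ≈⟨ +-congʳ (*-congʳ (⟦⟧-≋[] c c≋[])) ⟨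
    ⟦ c ⟧ * z + ⟦ d ⟧   ≈⟨ e ⟩
    0#                  ∎)

  private
    rows : ∀ γ → IsUnit (det γ) →
      ¬ (M₂.a γ A.≈ A.0# × M₂.b γ A.≈ A.0#) × ¬ (M₂.c γ A.≈ A.0# × M₂.d γ A.≈ A.0#)
    rows = MatrixProperties.rows≉0 A-ring (λ e → 𝔽.1≉0 (e .Polynomial.at 0))

  numer≉0 : ∀ γ {z} → z ∈Ω → numer γ z ≉ 0#
  numer≉0 (mat a b c d , unit) z∈Ω = linear≉0 a b z∈Ω (proj₁ (rows (mat a b c d) unit))

  j≉0 : ∀ γ {z} → z ∈Ω → j γ z ≉ 0#
  j≉0 (mat a b c d , unit) z∈Ω = linear≉0 c d z∈Ω (proj₂ (rows (mat a b c d) unit))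

  ⟦⟧-det : ∀ a b c d → ⟦ det (mat a b c d) ⟧ ≈ ⟦ a ⟧ * ⟦ d ⟧ - ⟦ b ⟧ * ⟦ c ⟧
  ⟦⟧-det a b c d = begin
    ⟦ a A.* d A.+ A.- (b A.* c) ⟧       ≈⟨ ⟦⟧-⊕ (a A.* d) _ ⟩
    ⟦ a A.* d ⟧ + ⟦ A.- (b A.* c) ⟧     ≈⟨ +-cong (⟦⟧-⊗ a d) (⟦⟧-⊝ (b A.* c)) ⟩
    ⟦ a ⟧ * ⟦ d ⟧ - ⟦ b A.* c ⟧         ≈⟨ +-congˡ (-‿cong (⟦⟧-⊗ b c)) ⟩
    ⟦ a ⟧ * ⟦ d ⟧ - ⟦ b ⟧ * ⟦ c ⟧       ∎

  -- The difference quotient minus the derivative, times j γ w, is K (w - z).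
  hasDerivative : ∀ γ {z} → z ∈Ω → HasDerivative (γ ∙_) z (detᴳ γ * (j γ z ⁻¹ * j γ z ⁻¹))
  hasDerivative γ@(mat a b c d , _) {z} z∈Ω r
    with v-finite (j≉0 γ z∈Ω)
  -- The first radius gives j γ w - j γ z a value of at least 1 + t, above t, so that j γ w also has
  -- value t. The second gives K (w - z) the value r + t, of which the division by j γ w uses up t.
  ... | t , vJ≡t with *-continuous ⟦ c ⟧ (1ℚ ℚ.+ t) | *-continuous K (r ℚ.+ t)
    where K = - (detᴳ γ * (j γ z ⁻¹ * j γ z ⁻¹) * ⟦ c ⟧)
  ...   | s₁ , near | s₂ , small = s₁ ℚ.⊔ s₂ , λ w w∈Ω w≉z w~z →
    ≼-cancelʳ
      (v-close vJ≡t (t<1+t t) (≼-cong (j-difference w) (near (≼-weaken (ℚ.p≤p⊔q s₁ s₂) w~z))))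
      (≼-cong (sym (error w w∈Ω w≉z)) (small (≼-weaken (ℚ.p≤q⊔p s₁ s₂) w~z)))
    where
    t<1+t : ∀ t → t ℚ.< 1ℚ ℚ.+ t
    t<1+t t = ≡.subst (ℚ._< 1ℚ ℚ.+ t) (ℚ.+-identityˡ t) (ℚ.+-monoˡ-< t (ℚ.positive⁻¹ 1ℚ))
    Δ = detᴳ γ
    J = j γ z
    J′ = J ⁻¹
    j-difference : ∀ w → ⟦ c ⟧ * (w - z) ≈ j γ w - j γ z
    j-difference w =
      solve 4 (λ c d w z → c :* (w :- z) := (c :* w :+ d) :- (c :* z :+ d)) refl _ ⟦ d ⟧ w z
    error : ∀ w → w ∈Ω → w ≉ z →
      ((γ ∙ w - γ ∙ z) * (w - z) ⁻¹ - Δ * (J′ * J′)) * j γ w ≈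
      - (Δ * (J′ * J′) * ⟦ c ⟧) * (w - z)
    error w w∈Ω w≉z = begin
      ((N₁ * I - N * J′) * U - Δ * (J′ * J′)) * J₁
        ≈⟨ solve 8 (λ N₁ I N J′ U Δ J₁ J → ((N₁ :* I :- N :* J′) :* U :- Δ :* (J′ :* J′)) :* J₁
             := N₁ :* U :* (J₁ :* I) :- N :* J′ :* U :* J₁ :- Δ :* J′ :* J′ :* J₁)
             refl N₁ I N J′ U Δ J₁ J ⟩
      N₁ * U * (J₁ * I) - N * J′ * U * J₁ - Δ * J′ * J′ * J₁
        ≈⟨ +-congʳ (+-congʳ (*-congˡ (trans (inverseʳ (j≉0 γ w∈Ω)) (sym (inverseʳ (j≉0 γ z∈Ω)))))) ⟩
      N₁ * U * (J * J′) - N * J′ * U * J₁ - Δ * J′ * J′ * J₁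
        ≈⟨ solve 7 (λ N₁ N J′ U Δ J₁ J →
               N₁ :* U :* (J :* J′) :- N :* J′ :* U :* J₁ :- Δ :* J′ :* J′ :* J₁
             := J′ :* ((N₁ :* J :- N :* J₁) :* U) :- Δ :* J′ :* J′ :* J₁)
             refl N₁ N J′ U Δ J₁ J ⟩
      J′ * ((N₁ * J - N * J₁) * U) - Δ * J′ * J′ * J₁
        ≈⟨ +-congʳ (*-congˡ (*-congʳ cross)) ⟩
      J′ * (Δ * (w - z) * U) - Δ * J′ * J′ * J₁
        ≈⟨ +-congʳ (*-congˡ (trans (*-assoc _ _ _)
             (*-congˡ (trans (inverseʳ w-z≉0) (sym (inverseʳ (j≉0 γ z∈Ω))))))) ⟩
      J′ * (Δ * (J * J′)) - Δ * J′ * J′ * J₁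
        ≈⟨ solve 4 (λ J′ Δ J₁ J → J′ :* (Δ :* (J :* J′)) :- Δ :* J′ :* J′ :* J₁
             := :- (Δ :* (J′ :* J′)) :* (J₁ :- J)) refl J′ Δ J₁ J ⟩
      - (Δ * (J′ * J′)) * (J₁ - J)
        ≈⟨ *-congˡ (j-difference w) ⟨
      - (Δ * (J′ * J′)) * (⟦ c ⟧ * (w - z))
        ≈⟨ solve 3 (λ x c w → :- x :* (c :* w) := :- (x :* c) :* w) refl _ _ _ ⟩
      - (Δ * (J′ * J′) * ⟦ c ⟧) * (w - z) ∎
      where
      N = numer γ z
      N₁ = numer γ w
      J₁ = j γ w
      I = J₁ ⁻¹
      U = (w - z) ⁻¹
      w-z≉0 : w - z ≉ 0#
      w-z≉0 e = w≉z (trans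
        (solve 2 (λ w z → w := (w :- z) :+ z) refl w z) (trans (+-congʳ e) (+-identityˡ z)))
      cross : N₁ * J - N * J₁ ≈ Δ * (w - z)
      cross = trans
        (solve 6 (λ a b c d w z → (a :* w :+ b) :* (c :* z :+ d) :- (a :* z :+ b) :* (c :* w :+ d)
          := (a :* d :- b :* c) :* (w :- z)) refl ⟦ a ⟧ ⟦ b ⟧ ⟦ c ⟧ ⟦ d ⟧ w z)
        (*-congʳ (sym (⟦⟧-det a b c d)))

  -- The derivative of γ is det γ / j², and 1/γz is j / numer; one factor j cancels in their
  -- product.
  ϱ-term-isPullback : ∀ k γ → IsPullback k (γ ∙_) (s∞0^ k) (λ z → ϱ-term k z γ)
  ϱ-term-isPullback k γ z z∈Ω = Δ * (J ⁻¹ * J ⁻¹) , hasDerivative γ z∈Ω , (begin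
    Δ ^ k * (N ^ k * J ^ k) ⁻¹
      ≈⟨ *-congˡ (trans (⁻¹-cong (sym (^-distrib-* N J k))) (⁻¹-^ k (*-≉0 N≉0 J≉0))) ⟩
    Δ ^ k * ((N * J) ⁻¹) ^ k
      ≈⟨ ^-distrib-* Δ _ k ⟨
    (Δ * (N * J) ⁻¹) ^ k
      ≈⟨ ^-congˡ k base ⟩
    ((N * J ⁻¹) ⁻¹ * (Δ * (J ⁻¹ * J ⁻¹))) ^ k
      ≈⟨ ^-distrib-* _ _ k ⟩
    ((N * J ⁻¹) ⁻¹) ^ k * (Δ * (J ⁻¹ * J ⁻¹)) ^ k ∎)
    where
    Δ = detᴳ γ
    N = numer γ z
    J = j γ z
    N≉0 = numer≉0 γ z∈Ω
    J≉0 = j≉0 γ z∈Ω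
    base : Δ * (N * J) ⁻¹ ≈ (N * J ⁻¹) ⁻¹ * (Δ * (J ⁻¹ * J ⁻¹))
    base = begin
      Δ * (N * J) ⁻¹                             ≈⟨ *-congˡ (⁻¹-distrib-* N≉0 J≉0) ⟩
      Δ * (N ⁻¹ * J ⁻¹)
        ≈⟨ *-congˡ (*-congˡ (trans (*-congʳ (inverseʳ J≉0)) (*-identityˡ _))) ⟨
      Δ * (N ⁻¹ * ((J * J ⁻¹) * J ⁻¹))
        ≈⟨ solve 4 (λ Δ N J J′ → Δ :* (N :* ((J :* J′) :* J′))
             := (N :* J) :* (Δ :* (J′ :* J′))) refl Δ _ J _ ⟩
      (N ⁻¹ * J) * (Δ * (J ⁻¹ * J ⁻¹))           ≈⟨ *-congʳ (*-congˡ (⁻¹-involutive J≉0)) ⟨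
      (N ⁻¹ * J ⁻¹ ⁻¹) * (Δ * (J ⁻¹ * J ⁻¹))     ≈⟨ *-congʳ (⁻¹-distrib-* N≉0 (⁻¹-≉0 J≉0)) ⟨
      (N * J ⁻¹) ⁻¹ * (Δ * (J ⁻¹ * J ⁻¹))        ∎

-- Parametrising a coset of K by units and polynomials

module Cosets {f ℓf n} (𝔽 : FiniteField f ℓf (suc n)) where
  open Arithmetic 𝔽
  open FiniteFieldUnits 𝔽
  open MatrixProperties A-ring
  private
    module 𝔽 = FiniteField 𝔽
    module P = Polynomial 𝔽.commutativeRing
    module A = CommutativeRing A-ring
    module G = Setoid G-setoid
    module K\G = Setoid K\G-setoid

  const-unit : ∀ {α} → α 𝔽.≉ 𝔽.0# → const α A.* const (α 𝔽.⁻¹) A.≈ A.1#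
  const-unit {α} α≉0 = A.trans (P.const-* α (α 𝔽.⁻¹)) (P.∷-cong (𝔽.inverseʳ α≉0) P.≋-refl)

  -- ( α  −αβ ; 0 1 ) γ, so that its action on z is α (γz − β).
  rep : G → Fin n → A → G
  rep (γ , y , Δy≈1) i β =
    affine (const (unit i)) (A.- (const (unit i) A.* β)) *ₘ γ ,
    const (unit i 𝔽.⁻¹) A.* y ,
    rep-unit {const (unit i)} {const (unit i 𝔽.⁻¹)} {y} β γ (const-unit (unit≉0 i)) Δy≈1

  rep-≈ᴷ : ∀ γ i β → γ ≈ᴷ rep γ i β
  rep-≈ᴷ (γ , _) i β = unit i , A.- (const (unit i) A.* β) , unit≉0 i , Setoid.refl M₂-setoid

  ≈⇒≈ᴷ : ∀ {γ δ} → γ G.≈ δ → γ ≈ᴷ δ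
  ≈⇒≈ᴷ {γ} {δ} e = 𝔽.1# , A.0# , 𝔽.1≉0 ,
    Setoid.trans M₂-setoid (G.sym {γ} {δ} e) (affine-refl (proj₁ γ))

  rep-coset : ∀ γ δ i i′ β β′ → rep γ i β G.≈ rep δ i′ β′ → γ ≈ᴷ δ
  rep-coset γ δ i i′ β β′ e = K\G.trans {γ} {rep γ i β} {δ} (rep-≈ᴷ γ i β)
    (K\G.trans {rep γ i β} {rep δ i′ β′} {δ} (≈⇒≈ᴷ {rep γ i β} {rep δ i′ β′} e)
      (K\G.sym {δ} {rep δ i′ β′} (rep-≈ᴷ δ i′ β′)))

  rep-injective : ∀ γ {i i′ β β′} → rep γ i β G.≈ rep γ i′ β′ → i ≡ i′ × β A.≈ β′
  rep-injective (γ , Δ-unit) {i} {i′} {β} {β′} e = from-entries (affine-injective γ Δ-unit e)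
    where
    from-entries : const (unit i) A.≈ const (unit i′) ×
      A.- (const (unit i) A.* β) A.≈ A.- (const (unit i′) A.* β′) → i ≡ i′ × β A.≈ β′
    from-entries (α≈ , αβ≈) with unit-injective {i} {i′} (α≈ .P.at 0)
    ... | ≡.refl = ≡.refl ,
      -[u*x]-injective {const (unit i)} {const (unit i 𝔽.⁻¹)} {β} {β′} (const-unit (unit≉0 i)) αβ≈

  rep-surjective : ∀ γ δ → γ ≈ᴷ δ → ∃₂ λ i β → δ G.≈ rep γ i β
  rep-surjective (γ , _) (δ , _) (α , β , α≉0 , e) with unit-surjective α≉0
  -- The upper right entry β of the given element of K must be -α times the new parameter, which is
  -- therefore -β/α.
  ... | i , unit≈α = i , A.- (const (unit i 𝔽.⁻¹) A.* β) ,
    Setoid.trans M₂-setoid e (*ₘ-affine-cong {const α} {const (unit i)} {β}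
      {A.- (const (unit i) A.* (A.- (const (unit i 𝔽.⁻¹) A.* β)))} γ
      (P.∷-cong (𝔽.sym unit≈α) P.≋-refl)
      (-[u*x]-surjective {const (unit i)} {const (unit i 𝔽.⁻¹)} β (const-unit (unit≉0 i))))

  rep-cong : ∀ γ {i i′ β β′} → i ≡ i′ → β A.≈ β′ → rep γ i β G.≈ rep γ i′ β′
  rep-cong (γ , _) {i} {_} {β} {β′} ≡.refl e =
    *ₘ-affine-cong {α} {α} {A.- (α A.* β)} {A.- (α A.* β′)} γ A.refl (A.-‿cong (A.*-congˡ {α} e))
    where α = const (unit i)

-- Unfolding ϱ along the cosets of K

module UnfoldedSums {f ℓf n} {𝔽 : FiniteField f ℓf (suc n)} {c ℓ} (ℂ∞ : CInfinity 𝔽 c ℓ) where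
  open CInfinity ℂ∞
  open Arithmetic 𝔽
  open Drinfeld ℂ∞
  open Evaluation ℂ∞
  open HalfPlane ℂ∞
  open Cosets 𝔽
  open FiniteFieldUnits 𝔽
  open FiniteFieldProperties 𝔽 using (_≋?_)
  open ValuedFieldProperties valuedField
  open IntegerSolver commutativeRing
  open SetoidReasoning setoid
  open Exp commutativeSemiring using (^-congˡ; ^-distrib-*; ^-homo-*; ^-assocʳ)
  open Mult semiring using () renaming (_×_ to _×ₙ_)
  private
    module 𝔽 = FiniteField 𝔽
    module 𝔽× = Mult 𝔽.semiring
    module A = CommutativeRing A-ring
    module ι = IsRingHomomorphism ι-hom
    module G = Setoid G-setoid
    module K\G = Setoid K\G-setoid

  ι≉0 : ∀ {α} → α 𝔽.≉ 𝔽.0# → ι α ≉ 0#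
  ι≉0 α≉0 = v≡[]⇒≉0 (v-ι α≉0)

  ι-^ : ∀ α m → ι (α 𝔽.^ m) ≈ ι α ^ m
  ι-^ α zero    = ι.1#-homo
  ι-^ α (suc m) = trans (ι.*-homo α _) (*-congˡ (ι-^ α m))

  ι-× : ∀ m → ι (m 𝔽×.× 𝔽.1#) ≈ m ×ₙ 1#
  ι-× zero    = ι.0#-homo
  ι-× (suc m) = trans (ι.+-homo 𝔽.1# _) (+-cong ι.1#-homo (ι-× m))

  sumMap-const : ∀ {i} {I : Set i} x (xs : List I) →
    sumMap (λ _ → x) xs ≈ (length xs ×ₙ 1#) * x
  sumMap-const x []       = sym (zeroˡ x)
  sumMap-const x (_ ∷ xs) =
    trans (+-cong (sym (*-identityˡ x)) (sumMap-const x xs)) (sym (distribʳ x _ _))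

  -- Through ι, the relation q · 1 = 0 holds in ℂ∞, so n = q - 1 acts as -1.
  sumMap-units : ∀ x → sumMap (λ _ → x) (allFin n) ≈ - x
  sumMap-units x = begin
    sumMap (λ _ → x) (allFin n)        ≈⟨ sumMap-const x (allFin n) ⟩
    (length (allFin n) ×ₙ 1#) * x
      ≡⟨ ≡.cong (λ m → (m ×ₙ 1#) * x) (length-tabulate {n = n} id) ⟩
    (n ×ₙ 1#) * x
      ≈⟨ solve 2 (λ m x → m :* x := (con (+ 1) :+ m) :* x :- x) refl _ x ⟩
    (suc n ×ₙ 1#) * x - x
      ≈⟨ +-congʳ (*-congʳ (trans (sym (ι-× (suc n))) (trans (ι.⟦⟧-cong q×1≈0) ι.0#-homo))) ⟩
    0# * x - x                         ≈⟨ solve 1 (λ x → con (+ 0) :* x :- x := :- x) refl x ⟩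
    - x                                ∎

  ^-periodic-≤ : ∀ {x N l m} → x ^ N ≈ 1# → l ℕ.≤ m → N ∣ m ℕ.∸ l → x ^ l ≈ x ^ m
  ^-periodic-≤ {x} {N} {l} {m} x^N≈1 l≤m (divides t e) = begin
    x ^ l                     ≈⟨ *-identityʳ _ ⟨
    x ^ l * 1#                ≈⟨ *-congˡ (trans (^-congˡ t x^N≈1) (1^n≈1 t)) ⟨
    x ^ l * (x ^ N) ^ t       ≈⟨ *-congˡ (^-assocʳ x N t) ⟩
    x ^ l * x ^ (N ℕ.* t)     ≈⟨ ^-homo-* x l (N ℕ.* t) ⟨
    x ^ (l ℕ.+ N ℕ.* t)       ≡⟨ ≡.cong (λ i → x ^ (l ℕ.+ i)) (≡.trans (ℕ.*-comm N t) (≡.sym e)) ⟩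
    x ^ (l ℕ.+ (m ℕ.∸ l))     ≡⟨ ≡.cong (x ^_) (ℕ.m+[n∸m]≡n l≤m) ⟩
    x ^ m                     ∎

  ^-periodic : ∀ {x N l m} → x ^ N ≈ 1# → l ≡ m mod N → x ^ l ≈ x ^ m
  ^-periodic {x} {N} {l} {m} x^N≈1 N∣∣l-m∣ with ℕ.≤-total l m
  ... | inj₁ l≤m = ^-periodic-≤ x^N≈1 l≤m (≡.subst (N ∣_) (ℕ.m≤n⇒∣m-n∣≡n∸m l≤m) N∣∣l-m∣)
  ... | inj₂ m≤l = sym (^-periodic-≤ x^N≈1 m≤l (≡.subst (N ∣_) (ℕ.m≤n⇒∣n-m∣≡n∸m m≤l) N∣∣l-m∣))

  -- Units of A are nonzero constants, whose n-th powers are 1 by `fermat`. Hence any representative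
  -- of the exponent modulo q - 1 gives the same term.
  detᴳ-^ : ∀ γ {l m} → l ≡ m mod n → detᴳ γ ^ l ≈ detᴳ γ ^ m
  detᴳ-^ (γ , y , Δy≈1) {l} {m} with unit⇒const (det γ) y Δy≈1
  ... | α , α≉0 , Δ≈α = ^-periodic {l = l} {m} (begin
    ⟦ det γ ⟧ ^ n     ≈⟨ ^-congˡ n (trans (⟦⟧-cong Δ≈α) (⟦⟧-const α)) ⟩
    ι α ^ n           ≈⟨ ι-^ α n ⟨
    ι (α 𝔽.^ n)       ≈⟨ ι.⟦⟧-cong (fermat α≉0) ⟩
    ι 𝔽.1#            ≈⟨ ι.1#-homo ⟩
    1#                ∎)

  ⟦⟧-linear : ∀ p q x y → ⟦ p A.* x A.+ q A.* y ⟧ ≈ ⟦ p ⟧ * ⟦ x ⟧ + ⟦ q ⟧ * ⟦ y ⟧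
  ⟦⟧-linear p q x y = trans (⟦⟧-⊕ (p A.* x) (q A.* y)) (+-cong (⟦⟧-⊗ p x) (⟦⟧-⊗ q y))

  j-rep : ∀ γ i β z → j (rep γ i β) z ≈ j γ z
  j-rep (mat a b c d , _) i β z = +-cong (*-congʳ (bottom a c)) (bottom b d)
    where
    bottom : ∀ x y → ⟦ A.0# A.* x A.+ A.1# A.* y ⟧ ≈ ⟦ y ⟧
    bottom x y = trans (⟦⟧-linear A.0# A.1# x y) (trans (+-congˡ (*-congʳ ⟦⟧-1))
      (solve 2 (λ x y → con (+ 0) :* x :+ con (+ 1) :* y := y) refl _ _))

  numer-rep : ∀ γ i β z → numer (rep γ i β) z ≈ ι (unit i) * (numer γ z - ⟦ β ⟧ * j γ z)
  numer-rep (mat a b c d , _) i β z = trans (+-cong (*-congʳ (top a c)) (top b d))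
    (solve 7 (λ u β a b c d z → u :* (a :- β :* c) :* z :+ u :* (b :- β :* d) :=
      u :* ((a :* z :+ b) :- β :* (c :* z :+ d))) refl _ _ _ _ _ _ z)
    where
    α = const (unit i)
    top : ∀ x y → ⟦ α A.* x A.+ (A.- (α A.* β)) A.* y ⟧ ≈ ι (unit i) * (⟦ x ⟧ - ⟦ β ⟧ * ⟦ y ⟧)
    top x y = begin
      ⟦ α A.* x A.+ (A.- (α A.* β)) A.* y ⟧
        ≈⟨ ⟦⟧-linear α (A.- (α A.* β)) x y ⟩
      ⟦ α ⟧ * ⟦ x ⟧ + ⟦ A.- (α A.* β) ⟧ * ⟦ y ⟧
        ≈⟨ +-congˡ (*-congʳ (trans (⟦⟧-⊝ (α A.* β)) (-‿cong (⟦⟧-⊗ α β)))) ⟩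
      ⟦ α ⟧ * ⟦ x ⟧ + (- (⟦ α ⟧ * ⟦ β ⟧)) * ⟦ y ⟧
        ≈⟨ solve 4 (λ α x β y → α :* x :+ (:- (α :* β)) :* y := α :* (x :- β :* y)) refl _ _ _ _ ⟩
      ⟦ α ⟧ * (⟦ x ⟧ - ⟦ β ⟧ * ⟦ y ⟧)
        ≈⟨ *-congʳ (⟦⟧-const (unit i)) ⟩
      ι (unit i) * (⟦ x ⟧ - ⟦ β ⟧ * ⟦ y ⟧) ∎

  detᴳ-rep : ∀ γ i β → detᴳ (rep γ i β) ≈ ι (unit i) * detᴳ γ
  detᴳ-rep (γ , _) i β = trans
    (⟦⟧-cong (MatrixProperties.det-affine A-ring (const (unit i)) (A.- (const (unit i) A.* β)) γ))
    (trans (⟦⟧-⊗ (const (unit i)) (det γ)) (*-congʳ (⟦⟧-const (unit i))))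

  ∙-difference : ∀ γ β {z} → z ∈Ω → (γ ∙ z - ⟦ β ⟧) * j γ z ≈ numer γ z - ⟦ β ⟧ * j γ z
  ∙-difference γ β {z} z∈Ω = begin
    (numer γ z * j γ z ⁻¹ - ⟦ β ⟧) * j γ z
      ≈⟨ solve 4 (λ N J′ b J → (N :* J′ :- b) :* J := N :* (J′ :* J) :- b :* J) refl _ _ _ (j γ z) ⟩
    numer γ z * (j γ z ⁻¹ * j γ z) - ⟦ β ⟧ * j γ z
      ≈⟨ +-congʳ (trans (*-congˡ (inverseˡ (j≉0 γ z∈Ω))) (*-identityʳ _)) ⟩
    numer γ z - ⟦ β ⟧ * j γ z ∎

  -- Up to the factors α and j_γ(z), γz - β is the numerator of `rep γ i β`, again an element of G,
  -- and such numerators have no zero in Ω. The unit 1 supplies an index i.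
  ∙≉⟦⟧ : ∀ γ β {z} → z ∈Ω → γ ∙ z - ⟦ β ⟧ ≉ 0#
  ∙≉⟦⟧ γ β {z} z∈Ω e with unit-surjective 𝔽.1≉0
  ... | i , _ = numer≉0 (rep γ i β) z∈Ω (begin
    numer (rep γ i β) z                        ≈⟨ numer-rep γ i β z ⟩
    ι (unit i) * (numer γ z - ⟦ β ⟧ * j γ z)   ≈⟨ *-congˡ (∙-difference γ β z∈Ω) ⟨
    ι (unit i) * ((γ ∙ z - ⟦ β ⟧) * j γ z)     ≈⟨ *-congˡ (trans (*-congʳ e) (zeroˡ _)) ⟩
    ι (unit i) * 0#                            ≈⟨ zeroʳ _ ⟩
    0#                                         ∎)

  ∙∉A : ∀ γ {z} → z ∈Ω → ¬ (∃[ b ] γ ∙ z ≈ ⟦ b ⟧)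
  ∙∉A γ z∈Ω (b , e) = ∙≉⟦⟧ γ b z∈Ω (trans (+-congʳ e) (-‿inverseʳ _))

  -- The factor of the term of ϱ that is common to the whole fibre over γ; what remains is a term of
  -- the Goss sum at γz.
  weight : ℕ → Carrier → G → Carrier
  weight k z γ = detᴳ γ ^ k * (j γ z ^ (2 ℕ.* k)) ⁻¹

  ϱ-term-rep : ∀ k γ i β {z} → z ∈Ω →
    ϱ-term k z (rep γ i β) ≈ weight k z γ * ((γ ∙ z - ⟦ β ⟧) ^ k) ⁻¹
  ϱ-term-rep k γ i β {z} z∈Ω = begin
    detᴳ (rep γ i β) ^ k * (numer (rep γ i β) z ^ k * j (rep γ i β) z ^ k) ⁻¹
      ≈⟨ *-cong (^-congˡ k (detᴳ-rep γ i β)) (⁻¹-cong (*-cong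
           (^-congˡ k (trans (numer-rep γ i β z) (*-congˡ (sym (∙-difference γ β z∈Ω)))))
           (^-congˡ k (j-rep γ i β z)))) ⟩
    (u * Δ) ^ k * ((u * (W * J)) ^ k * J ^ k) ⁻¹
      ≈⟨ *-congˡ (trans (⁻¹-cong (sym (^-distrib-* _ J k)))
             (⁻¹-^ k (*-≉0 (*-≉0 u≉0 (*-≉0 W≉0 J≉0)) J≉0))) ⟩
    (u * Δ) ^ k * ((u * (W * J) * J) ⁻¹) ^ k
      ≈⟨ ^-distrib-* _ _ k ⟨
    (u * Δ * (u * (W * J) * J) ⁻¹) ^ k
      ≈⟨ ^-congˡ k base ⟩
    (Δ * (J * J) ⁻¹ * W ⁻¹) ^ k
      ≈⟨ trans (^-distrib-* _ _ k) (*-congʳ (^-distrib-* _ _ k)) ⟩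
    Δ ^ k * ((J * J) ⁻¹) ^ k * (W ⁻¹) ^ k
      ≈⟨ *-cong (*-congˡ (trans (sym (⁻¹-^ k (*-≉0 J≉0 J≉0))) (⁻¹-cong square)))
             (sym (⁻¹-^ k W≉0)) ⟩
    Δ ^ k * (J ^ (2 ℕ.* k)) ⁻¹ * (W ^ k) ⁻¹ ∎
    where
    u = ι (unit i)
    Δ = detᴳ γ
    J = j γ z
    W = γ ∙ z - ⟦ β ⟧
    u≉0 = ι≉0 (unit≉0 i)
    J≉0 = j≉0 γ z∈Ω
    W≉0 = ∙≉⟦⟧ γ β z∈Ω
    square : (J * J) ^ k ≈ J ^ (2 ℕ.* k)
    square = begin
      (J * J) ^ k           ≈⟨ ^-distrib-* J J k ⟩
      J ^ k * J ^ k         ≈⟨ ^-homo-* J k k ⟨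
      J ^ (k ℕ.+ k)         ≡⟨ ≡.cong (λ l → J ^ (k ℕ.+ l)) (ℕ.+-identityʳ k) ⟨
      J ^ (2 ℕ.* k)         ∎
    base : u * Δ * (u * (W * J) * J) ⁻¹ ≈ Δ * (J * J) ⁻¹ * W ⁻¹
    base = begin
      u * Δ * (u * (W * J) * J) ⁻¹
        ≈⟨ *-congˡ (⁻¹-cong (solve 3 (λ u W J → u :* (W :* J) :* J
             := u :* (W :* (J :* J))) refl u W J)) ⟩
      u * Δ * (u * (W * (J * J))) ⁻¹
        ≈⟨ *-congˡ (trans (⁻¹-distrib-* u≉0 (*-≉0 W≉0 (*-≉0 J≉0 J≉0)))
             (*-congˡ (⁻¹-distrib-* W≉0 (*-≉0 J≉0 J≉0)))) ⟩
      u * Δ * (u ⁻¹ * (W ⁻¹ * (J * J) ⁻¹))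
        ≈⟨ solve 5 (λ u Δ u′ W′ J′ → u :* Δ :* (u′ :* (W′ :* J′))
             := (u :* u′) :* (Δ :* J′ :* W′)) refl u Δ _ _ _ ⟩
      (u * u ⁻¹) * (Δ * (J * J) ⁻¹ * W ⁻¹)
        ≈⟨ trans (*-congʳ (inverseʳ u≉0)) (*-identityˡ _) ⟩
      Δ * (J * J) ⁻¹ * W ⁻¹ ∎

  A-decSetoid : DecSetoid f ℓf
  A-decSetoid = record
    { isDecEquivalence = record { isEquivalence = A.isEquivalence ; _≟_ = _≋?_ } }

  P-hasSum : ∀ e_A k Gₖ → IsGossPolynomial e_A k Gₖ → ∀ {m} → m ≡ k mod n →
    ∀ {z s} → z ∈Ω → HasSum G-setoid (ϱ-term k z) s →
    HasSum K\G-setoid (P-term e_A Gₖ (2 ℕ.* k) m z) (- s)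
  P-hasSum e_A k Gₖ goss {m} m≡k {z} {s} z∈Ω = F.hasSum-fibres valuedField
    {ϱ-term k z} {λ γ β → weight k z γ * ((γ ∙ z - ⟦ β ⟧) ^ k) ⁻¹} {P-term e_A Gₖ (2 ℕ.* k) m z} {s}
    (λ γ i β → ϱ-term-rep k γ i β z∈Ω) sumMap-units fibre
    where
    module F = Fibration G.isEquivalence K\G.isEquivalence A-decSetoid rep
      rep-cong rep-injective rep-coset rep-surjective
    fibre : ∀ γ → HasSum A.setoid (λ β → weight k z γ * ((γ ∙ z - ⟦ β ⟧) ^ k) ⁻¹)
                                  (P-term e_A Gₖ (2 ℕ.* k) m z γ)
    -- The factor taken out of the Goss sum carries the exponent k; `detᴳ-^` replaces it by the
    -- given representative m.
    fibre γ = hasSum-cong (*-congʳ (*-congʳ (sym (detᴳ-^ γ {m} {k} m≡k))))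
      (hasSum-* A.setoid (weight k z γ) (goss (γ ∙ z) (∙∉A γ z∈Ω)))
      where
      hasSum-cong : ∀ {h x y} → x ≈ y → HasSum A.setoid h x → HasSum A.setoid h y
      hasSum-cong e h-sum r with h-sum r
      ... | L , p = L , λ M M! L⊆M → Close-cong refl e (p M M! L⊆M)

proposition6p2p2 :
  ∀ {f ℓf c ℓ} {q : ℕ} → OddPrimePower q →
  (𝔽 : FiniteField f ℓf q) (ℂ∞ : CInfinity 𝔽 c ℓ) →
  let open CInfinity ℂ∞
      open Arithmetic 𝔽
      open Drinfeld ℂ∞
  in
  (e_A : Carrier → Carrier) → Is-e_A e_A →
  (k : ℕ) → 1 ℕ.≤ k →
  (Gₖ : Poly) → IsGossPolynomial e_A k Gₖ →
  (ϱ : Carrier → Carrier) → Is-ϱ k ϱ →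
  (Σ[ η ∈ (G → Carrier → Carrier) ]
     (∀ γ → IsPullback k (γ ∙_) (s∞0^ k) (η γ)) ×
     (∀ z → z ∈Ω → HasSum G-setoid (λ γ → η γ z) (ϱ z)))
  ×
  (Σ[ P ∈ (Carrier → Carrier) ]
     Is-P e_A Gₖ (2 ℕ.* k) k P ×
     (∀ z → z ∈Ω → ϱ z ≈ - P z))
-- A field has an element, so q = 0 is impossible; writing q as `suc n` makes q - 1 reduce to n.
proposition6p2p2 {q = zero} _ 𝔽 _ _ _ _ _ _ _ _ _ =
  ⊥-elim (Fin.¬Fin0 (FiniteFieldProperties.index 𝔽 (FiniteField.0# 𝔽)))
proposition6p2p2 {q = suc n} _ 𝔽 ℂ∞ e_A _ k _ Gₖ goss ϱ ϱ-sum =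
  ((λ γ z → ϱ-term k z γ) , ϱ-term-isPullback k , ϱ-sum) ,
  -- Taking P to be -ϱ, everything rests on showing that the Poincaré series converges to this
  -- function.
  ((λ z → - ϱ z) ,
   (λ m m≡k z z∈Ω → P-hasSum e_A k Gₖ goss {m} m≡k {z} {ϱ z} z∈Ω (ϱ-sum z z∈Ω)) ,
   λ z _ → sym (RingProperties.-‿involutive ring (ϱ z)))
  where
  open CInfinity ℂ∞
  open Drinfeld ℂ∞
  open HalfPlane ℂ∞
  open UnfoldedSums ℂ∞
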